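{- Let $B$ be a $p\times q$ matrix, $G$ a $q\times q$ symmetric matrix and $G'$ a $p\times p$ symmetric matrix. Let $$A=\begin{bmatrix} G' & B & B\\ B^T & 0 & G\\ B^T & G & 0\end{bmatrix}\quad ((p+2q)\times(p+2q)),\qquad C=\begin{bmatrix} G & B^T & B^T\\ B & 0 & G'\\ B & G' & 0\end{bmatrix}\quad ((2p+q)\times(2p+q)).$$ Then $A\oplus\begin{bmatrix}0 & G'\\ G' & 0\end{bmatrix}\oplus G$ and $C\oplus\begin{bmatrix}0 & G\\ G & 0\end{bmatrix}\oplus G'$ are cospectral.
   Context: For matrices $X,Y$, $X\oplus Y=\begin{bmatrix} X&0\\0&Y\end{bmatrix}$, and $0$ denotes a zero matrix of appropriate size. Two square matrices are cospectral if they have the same eigenvalues with the same multiplicities. -}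

module Defs where

open import Level using (Level; _⊔_) renaming (suc to lsuc)
open import Algebra.Bundles using (CommutativeRing)
open import Algebra.Bundles.Raw using (RawRing)
open import Algebra.Apartness.Bundles using (HeytingField; HeytingCommutativeRing)
open import Algebra.Morphism.Structures using (module RingMorphisms)
import Algebra.Definitions.RawSemiring as RawSemiringDefinitions
open import Data.Fin.Base using (Fin; zero; suc; toℕ; punchIn)
open import Data.Fin.Properties using (_≟_)
open import Data.Bool.Base using (if_then_else_)
open import Data.List.Base as List using (List; []; _∷_)
open import Data.Nat.Base as ℕ using (ℕ; zero; suc)
open import Data.Product.Base using (_×_; ∃-syntax)
open import Data.Vec.Functional as Vector using (Vector)
open import Function.Bundles using (_⇔_)
open import Relation.Nullary.Decidable.Core using (⌊_⌋)

private
  variable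
    a b c ℓ ℓ₁ ℓ₂ : Level
    A : Set a
    m n k l : ℕ

------------------------------------------------------------------------
-- Matrices

Matrix : Set a → ℕ → ℕ → Set a
Matrix A m n = Vector (Vector A n) m

infix  9 _ᵀ
infixr 6 _∣_
infixr 5 _⟋_

_ᵀ : Matrix A m n → Matrix A n m
_ᵀ = Vector.transpose

mapᴹ : {B : Set b} → (A → B) → Matrix A m n → Matrix B m n
mapᴹ f = Vector.map (Vector.map f)

-- Block matrices: M ∣ N puts N to the right of M, and M ⟋ N puts N below M.

_∣_ : Matrix A m k → Matrix A m l → Matrix A m (k ℕ.+ l)
_∣_ = Vector.zipWith Vector._++_

_⟋_ : Matrix A k n → Matrix A l n → Matrix A (k ℕ.+ l) n
_⟋_ = Vector._++_

------------------------------------------------------------------------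
-- Matrices and polynomials with entries in a ring

module RingDefs (R : RawRing c ℓ) where
  open RawRing R
  open RawSemiringDefinitions rawSemiring using (sum; _^_)

  infixr 4 _⊕_
  infix  8 -ᴾ_
  infixl 7 _*ᴾ_
  infixl 6 _+ᴾ_
  infix  4 _≈ᴾ_

  O : Matrix Carrier m n
  O _ _ = 0#

  _⊕_ : Matrix Carrier m m → Matrix Carrier n n → Matrix Carrier (m ℕ.+ n) (m ℕ.+ n)
  M ⊕ N = (M ∣ O)
        ⟋ (O ∣ N)

  Symmetric : Matrix Carrier n n → Set ℓ
  Symmetric M = ∀ i j → M i j ≈ M j i

  δ : Fin n → Fin n → Carrier
  δ i j = if ⌊ i ≟ j ⌋ then 1# else 0#

  -- Laplace expansion along the first row.
  det : Matrix Carrier n n → Carrier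
  det {zero}  M = 1#
  det {suc n} M =
    sum λ j → (- 1#) ^ toℕ j * M zero j * det (λ r s → M (suc r) (punchIn j s))

  -- A polynomial is its list of coefficients, constant term first. Trailing
  -- zeros are allowed, so equality of polynomials is _≈ᴾ_ rather than equality
  -- of lists.
  Poly : Set c
  Poly = List Carrier

  coeff : Poly → ℕ → Carrier
  coeff []      _       = 0#
  coeff (x ∷ f) zero    = x
  coeff (x ∷ f) (suc i) = coeff f i

  _≈ᴾ_ : Poly → Poly → Set ℓ
  f ≈ᴾ g = ∀ i → coeff f i ≈ coeff g i

  _+ᴾ_ : Poly → Poly → Poly
  []      +ᴾ g       = g
  (x ∷ f) +ᴾ []      = x ∷ f
  (x ∷ f) +ᴾ (y ∷ g) = (x + y) ∷ (f +ᴾ g)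

  _*ᴾ_ : Poly → Poly → Poly
  []      *ᴾ g = []
  (x ∷ f) *ᴾ g = List.map (x *_) g +ᴾ (0# ∷ (f *ᴾ g))

  -ᴾ_ : Poly → Poly
  -ᴾ_ = List.map (-_)

  polyRawRing : RawRing c ℓ
  polyRawRing = record
    { Carrier = Poly
    ; _≈_     = _≈ᴾ_
    ; _+_     = _+ᴾ_
    ; _*_     = _*ᴾ_
    ; -_      = -ᴾ_
    ; 0#      = []
    ; 1#      = 1# ∷ []
    }

  eval : Poly → Carrier → Carrier
  eval []      x = 0#
  eval (y ∷ f) x = y + x * eval f x

-- The matrix x I - M over R[x]; its (i , j) entry is - M i j + δ i j x.
charMatrix : (R : RawRing c ℓ) →
             Matrix (RawRing.Carrier R) n n → Matrix (RingDefs.Poly R) n n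
charMatrix R M i j = - M i j ∷ RingDefs.δ R i j ∷ []
  where open RawRing R

charPoly : (R : RawRing c ℓ) → Matrix (RawRing.Carrier R) n n → RingDefs.Poly R
charPoly R M = RingDefs.det (RingDefs.polyRawRing R) (charMatrix R M)

------------------------------------------------------------------------
-- Eigenvalues and cospectrality over a field

rawRing : HeytingField c ℓ₁ ℓ₂ → RawRing c ℓ₁
rawRing K = CommutativeRing.rawRing
  (HeytingCommutativeRing.commutativeRing (HeytingField.heytingCommutativeRing K))

module FieldDefs (K : HeytingField c ℓ₁ ℓ₂) where
  open HeytingField K using (Carrier; _#_; -_; 0#; 1#)
  open RingDefs (rawRing K) using (Poly; _≈ᴾ_; _*ᴾ_; polyRawRing; eval)
  open RawSemiringDefinitions (RawRing.rawSemiring polyRawRing) using (_^_)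

  -- x - μ
  linear : Carrier → Poly
  linear μ = - μ ∷ 1# ∷ []

  -- μ is a root of f of multiplicity exactly k. Multiplicity 0 means that μ is
  -- not a root.
  IsRootOfMultiplicity : Poly → Carrier → ℕ → Set (c ⊔ ℓ₁ ⊔ ℓ₂)
  IsRootOfMultiplicity f μ k =
    ∃[ g ] f ≈ᴾ linear μ ^ k *ᴾ g × eval g μ # 0#

  -- Algebraic multiplicity; μ is an eigenvalue of M iff this holds for some
  -- k ≥ 1.
  IsEigenvalueOfMultiplicity : Matrix Carrier n n → Carrier → ℕ → Set (c ⊔ ℓ₁ ⊔ ℓ₂)
  IsEigenvalueOfMultiplicity M = IsRootOfMultiplicity (charPoly (rawRing K) M)

-- The field is arbitrary, so the eigenvalues of a matrix need not lie in it:
-- they are compared in every extension field L, in particular in an algebraic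
-- closure.
Cospectral : (K : HeytingField c ℓ₁ ℓ₂) →
             Matrix (HeytingField.Carrier K) m m → Matrix (HeytingField.Carrier K) n n →
             Set (lsuc (c ⊔ ℓ₁ ⊔ ℓ₂))
Cospectral {c} {ℓ₁} {ℓ₂} K M N =
  (L : HeytingField c ℓ₁ ℓ₂) →
  let open RingMorphisms (rawRing K) (rawRing L) using (IsRingHomomorphism)
      open FieldDefs L using (IsEigenvalueOfMultiplicity)
  in
  (ι : HeytingField.Carrier K → HeytingField.Carrier L) → IsRingHomomorphism ι →
  (μ : HeytingField.Carrier L) (k : ℕ) →
  IsEigenvalueOfMultiplicity (mapᴹ ι M) μ k ⇔ IsEigenvalueOfMultiplicity (mapᴹ ι N) μ k

{-# OPTIONS --safe #-}
module Submission where

-- Over any commutative ring, subtracting the second block row of A from the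
-- third and adding the third block column to the second is a conjugation which
-- makes A block triangular, so χ(A) = χ(S) χ(-G) with S = [ G′ 2B ; Bᵀ G ].
-- The case p = 0 gives χ [ 0 G ; G 0 ] = χ(G) χ(-G). Exchanging the roles of
-- (B , G) and (Bᵀ , G′) turns S into its transpose with the two blocks
-- interchanged, because G and G′ are symmetric. Hence both direct sums have
-- characteristic polynomial χ(S) χ(G) χ(-G) χ(G′) χ(-G′), in every
-- characteristic.

open import Defs
open import Level using (0ℓ)
open import Algebra.Apartness.Bundles using (HeytingField; HeytingCommutativeRing)
open import Algebra.Bundles using (AbelianGroup; CommutativeRing; Semiring)
open import Algebra.Morphism.Structures using (module RingMorphisms)
open import Data.Fin.Base using (Fin; zero; suc; toℕ; punchIn; lift; splitAt; _↑ˡ_; _↑ʳ_)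
open import Data.Fin.Properties using (_≟_; suc-injective; toℕ-↑ˡ; splitAt-↑ˡ; splitAt-↑ʳ; ↑ˡ-injective; ↑ʳ-injective; +↔⊎)
import Data.Fin.Permutation as Perm
import Data.Fin.Permutation.Components as PC
open import Data.Fin.Permutation.Transposition.List using (TranspositionList; eval; decompose; eval-decompose)
open import Data.List.Base as List using ([]; _∷_)
open import Data.Nat.Base as ℕ using (ℕ; zero; suc)
open import Data.Product.Base using (_,_)
open import Data.Sum.Base using (_⊎_; inj₁; inj₂; swap)
open import Data.Sum.Function.Propositional using (_⊎-↔_)
open import Data.Sum.Properties using (inj₁-injective; inj₂-injective)
open import Data.Vec.Functional as Vector using (Vector; updateAt; tail)
open import Data.Vec.Functional.Properties using (updateAt-updates; updateAt-minimal)
open import Function.Base using (_∘_; const)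
open import Function.Bundles using (_↔_; mk⇔; Inverse)
open import Function.Construct.Composition using (_↔-∘_)
open import Function.Construct.Identity using (↔-id)
open import Function.Construct.Symmetry using (↔-sym)
open import Function.Definitions using (Injective)
open import Function.Related.TypeIsomorphisms using (⊎-assoc; ⊎-comm)
open import Relation.Binary.PropositionalEquality as ≡ using (_≡_; _≢_)
open import Relation.Binary.Structures using (IsEquivalence)
open import Relation.Nullary.Decidable using (dec-true; dec-false)
open import Relation.Nullary.Decidable.Core using (Dec; yes; no)
open import Relation.Nullary.Negation using (contradiction)

-- The determinant is available only as expansion along the first row, and it is needed over `R[x]`,
-- so its laws are derived without division. The argument "a swap changes the sign, so equal rows
-- give `det M ≈ - det M`" proves nothing in characteristic 2; alternation therefore comes first,
-- and the sign of a swap is deduced from it. The familiar route rotates the last two blocks by 45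
-- degrees, which needs 1/√2 and yields a symmetric matrix with off-diagonal blocks √2 B and √2 Bᵀ.
-- The unipotent conjugation stays inside the ring; its price is the asymmetric pair 2B, Bᵀ, which
-- transposition followed by the interchange of blocks absorbs. Multiplicities depend on a matrix
-- only through its characteristic polynomial up to `_≈ᴾ_`, so an identity of such polynomials over
-- each extension field is all that is required.

-- Values of transpositions, and column deletion in a split index range.

transpose-fst : ∀ {n} (i j : Fin n) → PC.transpose i j i ≡ j
transpose-fst i j rewrite dec-true (i ≟ i) ≡.refl = ≡.refl

transpose-snd : ∀ {n} {i j : Fin n} → i ≢ j → PC.transpose i j j ≡ i
transpose-snd {i = i} {j} i≢j
  rewrite dec-false (j ≟ i) (i≢j ∘ ≡.sym) | dec-true (j ≟ j) ≡.refl = ≡.refl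

transpose-other : ∀ {n} {i j k : Fin n} → k ≢ i → k ≢ j → PC.transpose i j k ≡ k
transpose-other {i = i} {j} {k} k≢i k≢j
  rewrite dec-false (k ≟ i) k≢i | dec-false (k ≟ j) k≢j = ≡.refl

transpose-same : ∀ {n} (i k : Fin n) → PC.transpose i i k ≡ k
transpose-same i k with k ≟ i
... | yes ≡.refl = ≡.refl
... | no  k≢i rewrite dec-false (k ≟ i) k≢i = ≡.refl

-- For `det-block`: deleting a column of the left block leaves a matrix that is again split, with a
-- minor of the left block and the right block untouched.
punchIn-↑ˡ-↑ˡ : ∀ {m} n (j : Fin (suc m)) (s : Fin m) → punchIn (j ↑ˡ n) (s ↑ˡ n) ≡ punchIn j s ↑ˡ n
punchIn-↑ˡ-↑ˡ n zero    s       = ≡.refl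
punchIn-↑ˡ-↑ˡ n (suc j) zero    = ≡.refl
punchIn-↑ˡ-↑ˡ n (suc j) (suc s) = ≡.cong suc (punchIn-↑ˡ-↑ˡ n j s)

punchIn-↑ˡ-↑ʳ : ∀ m {n} (j : Fin (suc m)) (s : Fin n) → punchIn (j ↑ˡ n) (m ↑ʳ s) ≡ suc m ↑ʳ s
punchIn-↑ˡ-↑ʳ m       zero    s = ≡.refl
punchIn-↑ˡ-↑ʳ (suc m) (suc j) s = ≡.cong suc (punchIn-↑ˡ-↑ʳ m j s)

-- Determinants over a commutative ring

module Determinant {r ℓ} (R : CommutativeRing r ℓ) where
  open CommutativeRing R hiding (zero; rawRing)
  open RingDefs (CommutativeRing.rawRing R) using (det)
  open import Algebra.Properties.Semiring.Sum semiring
  open import Algebra.Properties.Ring ring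
  open import Algebra.Definitions.RawSemiring (Semiring.rawSemiring semiring) using (_^_)
  open import Algebra.Solver.Ring.NaturalCoefficients.Default commutativeSemiring
    using (solve; _:=_; _:+_; _:*_)
  open import Relation.Binary.Reasoning.Setoid setoid

  infix 4 _≋_

  _≋_ : ∀ {m n} → Matrix Carrier m n → Matrix Carrier m n → Set ℓ
  M ≋ N = ∀ i j → M i j ≈ N i j

  sign : ∀ {n} → Fin n → Carrier
  sign j = (- 1#) ^ toℕ j

  minor : ∀ {m n} → Matrix Carrier (suc m) (suc n) → Fin (suc n) → Matrix Carrier m n
  minor M j r s = M (suc r) (punchIn j s)

  -- Opaque, so that unification recovers f from ∑ f also when n is a successor.
  opaque
    ∑ : ∀ {n} → Vector Carrier n → Carrier
    ∑ = sum

    ∑-suc : ∀ {n} {f : Vector Carrier (suc n)} → ∑ f ≈ f zero + ∑ (λ i → f (suc i))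
    ∑-suc = refl

    ∑-cong : ∀ {n} {f g : Vector Carrier n} → (∀ i → f i ≈ g i) → ∑ f ≈ ∑ g
    ∑-cong = sum-cong-≋

    ∑-zero : ∀ {n} {f : Vector Carrier n} → (∀ i → f i ≈ 0#) → ∑ f ≈ 0#
    ∑-zero {n} f≈0 = trans (sum-cong-≋ f≈0) (sum-replicate-zero n)

    ∑-+ : ∀ {n} {f g : Vector Carrier n} → ∑ (λ i → f i + g i) ≈ ∑ f + ∑ g
    ∑-+ {f = f} {g} = ∑-distrib-+ f g

    ∑-*ˡ : ∀ {n} a {f : Vector Carrier n} → ∑ (λ i → a * f i) ≈ a * ∑ f
    ∑-*ˡ a {f} = sym (*-distribˡ-sum a f)

    ∑-*ʳ : ∀ {n} {f : Vector Carrier n} a → ∑ (λ i → f i * a) ≈ ∑ f * a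
    ∑-*ʳ {f = f} a = sym (*-distribʳ-sum a f)

    ∑-swap : ∀ {m n} {f : Fin m → Fin n → Carrier} →
             ∑ (λ i → ∑ (λ j → f i j)) ≈ ∑ (λ j → ∑ (λ i → f i j))
    ∑-swap {f = f} = ∑-comm f

    ∑-↑ : ∀ m {n} {f : Vector Carrier (m ℕ.+ n)} →
          ∑ f ≈ ∑ (λ i → f (i ↑ˡ n)) + ∑ (λ j → f (m ↑ʳ j))
    ∑-↑ zero    = sym (+-identityˡ _)
    ∑-↑ (suc m) {f = f} = trans (+-congˡ (∑-↑ m {f = tail f})) (sym (+-assoc _ _ _))

    det-expand : ∀ {n} (M : Matrix Carrier (suc n) (suc n)) →
                 det M ≈ ∑ (λ j → sign j * M zero j * det (minor M j))
    det-expand M = refl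

  -- Congruence and linearity in one row.

  det-cong : ∀ {n} {M N : Matrix Carrier n n} → M ≋ N → det M ≈ det N
  det-cong {zero}  M≋N = refl
  det-cong {suc n} {M} {N} M≋N = begin
    det M                                             ≈⟨ det-expand M ⟩
    ∑ (λ j → sign j * M zero j * det (minor M j))     ≈⟨ ∑-cong (λ j → *-cong (*-congˡ (M≋N zero j))
                                                           (det-cong λ r s → M≋N (suc r) (punchIn j s))) ⟩
    ∑ (λ j → sign j * N zero j * det (minor N j))     ≈⟨ det-expand N ⟨
    det N                                             ∎

  -- Additivity and scaling are kept in one statement so that a single induction covers both;
  -- `b = 0#` recovers scaling.
  det-linear : ∀ {n} (i : Fin n) a b {K M N : Matrix Carrier n n} →
               (∀ j → K i j ≈ a * M i j + b * N i j) →
               (∀ r → r ≢ i → ∀ j → K r j ≈ M r j) →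
               (∀ r → r ≢ i → ∀ j → K r j ≈ N r j) →
               det K ≈ a * det M + b * det N
  det-linear {suc n} i a b {K} {M} {N} K≈aM+bN K≈M K≈N = begin
    det K                                             ≈⟨ det-expand K ⟩
    ∑ (term K)                                        ≈⟨ ∑-cong (expand i K≈aM+bN K≈M K≈N) ⟩
    ∑ (λ j → a * term M j + b * term N j)             ≈⟨ ∑-+ ⟩
    ∑ (λ j → a * term M j) + ∑ (λ j → b * term N j)   ≈⟨ +-cong (∑-*ˡ a) (∑-*ˡ b) ⟩
    a * ∑ (term M) + b * ∑ (term N)                   ≈⟨ +-cong (*-congˡ (det-expand M)) (*-congˡ (det-expand N)) ⟨
    a * det M + b * det N                             ∎
    where
    term : Matrix Carrier (suc n) (suc n) → Fin (suc n) → Carrier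
    term M j = sign j * M zero j * det (minor M j)

    expand : ∀ i →
             (∀ j → K i j ≈ a * M i j + b * N i j) →
             (∀ r → r ≢ i → ∀ j → K r j ≈ M r j) →
             (∀ r → r ≢ i → ∀ j → K r j ≈ N r j) →
             ∀ j → term K j ≈ a * term M j + b * term N j
    expand zero Ki KM KN j = begin
      sign j * K zero j * det (minor K j)
        ≈⟨ *-congʳ (*-congˡ (Ki j)) ⟩
      sign j * (a * M zero j + b * N zero j) * det (minor K j)
        ≈⟨ solve 6 (λ s a m b n d → s :* (a :* m :+ b :* n) :* d := a :* (s :* m :* d) :+ b :* (s :* n :* d))
             refl (sign j) a (M zero j) b (N zero j) (det (minor K j)) ⟩
      a * (sign j * M zero j * det (minor K j)) + b * (sign j * N zero j * det (minor K j))
        ≈⟨ +-cong (*-congˡ (*-congˡ (det-cong λ r s → KM (suc r) (λ ()) (punchIn j s))))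
                  (*-congˡ (*-congˡ (det-cong λ r s → KN (suc r) (λ ()) (punchIn j s)))) ⟩
      a * term M j + b * term N j ∎
    expand (suc i) Ki KM KN j = begin
      sign j * K zero j * det (minor K j)
        ≈⟨ *-congˡ (det-linear i a b (Ki ∘ punchIn j)
             (λ r r≢i → KM (suc r) (r≢i ∘ suc-injective) ∘ punchIn j)
             (λ r r≢i → KN (suc r) (r≢i ∘ suc-injective) ∘ punchIn j)) ⟩
      sign j * K zero j * (a * det (minor M j) + b * det (minor N j))
        ≈⟨ solve 6 (λ s k a m b n → s :* k :* (a :* m :+ b :* n) := a :* (s :* k :* m) :+ b :* (s :* k :* n))
             refl (sign j) (K zero j) a (det (minor M j)) b (det (minor N j)) ⟩
      a * (sign j * K zero j * det (minor M j)) + b * (sign j * K zero j * det (minor N j))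
        ≈⟨ +-cong (*-congˡ (*-congʳ (*-congˡ (KM zero (λ ()) j)))) (*-congˡ (*-congʳ (*-congˡ (KN zero (λ ()) j)))) ⟩
      a * term M j + b * term N j ∎

  -- Equal rows and row swaps.

  -- Alternation is recorded for a single pair of rows, so that row additions and swaps can already
  -- be used inside the induction that establishes it for all pairs.
  AlternatingAt : ∀ {n} → Fin n → Fin n → Set _
  AlternatingAt {n} i j = ∀ (M : Matrix Carrier n n) → (∀ k → M i k ≈ M j k) → det M ≈ 0#

  alternating-suc : ∀ {n} {i j : Fin n} → AlternatingAt i j → AlternatingAt (suc i) (suc j)
  alternating-suc alt M Mi≈Mj = trans (det-expand M) (∑-zero λ k →
    trans (*-congˡ (alt (minor M k) (Mi≈Mj ∘ punchIn k))) (zeroʳ _))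

  det-addRow : ∀ {n} {i j : Fin n} → i ≢ j → AlternatingAt i j →
               ∀ a {M N : Matrix Carrier n n} →
               (∀ k → N i k ≈ M i k + a * M j k) →
               (∀ r → r ≢ i → ∀ k → N r k ≈ M r k) →
               det N ≈ det M
  det-addRow {i = i} {j} i≢j alt a {M} {N} Ni Nr = begin
    det N                   ≈⟨ det-linear i a 1# Ni′ Nr′ Nr ⟩
    a * det P + 1# * det M  ≈⟨ +-cong (*-congˡ (alt P Pi≈Pj)) (*-identityˡ _) ⟩
    a * 0# + det M          ≈⟨ +-congʳ (zeroʳ a) ⟩
    0# + det M              ≈⟨ +-identityˡ _ ⟩
    det M                   ∎
    where
    P : Matrix Carrier _ _
    P = updateAt M i (const (M j))

    Pi : ∀ k → P i k ≡ M j k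
    Pi k = ≡.cong (λ v → v k) (updateAt-updates i M)

    Pr : ∀ r → r ≢ i → ∀ k → P r k ≡ M r k
    Pr r r≢i k = ≡.cong (λ v → v k) (updateAt-minimal r i M r≢i)

    Pi≈Pj : ∀ k → P i k ≈ P j k
    Pi≈Pj k = reflexive (≡.trans (Pi k) (≡.sym (Pr j (i≢j ∘ ≡.sym) k)))

    Ni′ : ∀ k → N i k ≈ a * P i k + 1# * M i k
    Ni′ k = begin
      N i k                    ≈⟨ Ni k ⟩
      M i k + a * M j k        ≈⟨ +-comm _ _ ⟩
      a * M j k + M i k        ≈⟨ +-cong (*-congˡ (reflexive (Pi k))) (*-identityˡ _) ⟨
      a * P i k + 1# * M i k   ∎

    Nr′ : ∀ r → r ≢ i → ∀ k → N r k ≈ P r k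
    Nr′ r r≢i k = trans (Nr r r≢i k) (reflexive (≡.sym (Pr r r≢i k)))

  -- Rows (x , y) become (x + y , y), (x + y , - x), (y , - x).
  det-swapRows : ∀ {n} {i j : Fin n} → i ≢ j → AlternatingAt i j → AlternatingAt j i →
                 (M : Matrix Carrier n n) → det (M ∘ PC.transpose i j) ≈ - det M
  det-swapRows {n} {i} {j} i≢j altij altji M = begin
    det N                      ≈⟨ -‿involutive (det N) ⟨
    - (- det N)                ≈⟨ -‿cong (sym det-P₃) ⟩
    - det P₃                   ≈⟨ -‿cong (det-addRow i≢j altij 1# P₃i P₃r) ⟩
    - det P₂                   ≈⟨ -‿cong (det-addRow (i≢j ∘ ≡.sym) altji (- 1#) P₂j P₂r) ⟩
    - det P₁                   ≈⟨ -‿cong (det-addRow i≢j altij 1# P₁i P₁r) ⟩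
    - det M                    ∎
    where
    N : Matrix Carrier n n
    N = M ∘ PC.transpose i j

    set : Matrix Carrier n n → Fin n → Vector Carrier n → Matrix Carrier n n
    set M i v = updateAt M i (const v)

    set-at : ∀ M i v k → set M i v i k ≡ v k
    set-at M i v k = ≡.cong (λ w → w k) (updateAt-updates i M)

    set-away : ∀ M i v r → r ≢ i → ∀ k → set M i v r k ≡ M r k
    set-away M i v r r≢i k = ≡.cong (λ w → w k) (updateAt-minimal r i M r≢i)

    P₁ P₂ P₃ : Matrix Carrier n n
    P₁ = set M i (λ k → M i k + 1# * M j k)
    P₂ = set P₁ j (λ k → P₁ j k + - 1# * P₁ i k)
    P₃ = set P₂ i (λ k → P₂ i k + 1# * P₂ j k)

    P₁i = λ k → reflexive (set-at M i (λ k → M i k + 1# * M j k) k)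
    P₁r = λ r r≢i k → reflexive (set-away M i (λ k → M i k + 1# * M j k) r r≢i k)
    P₂j = λ k → reflexive (set-at P₁ j (λ k → P₁ j k + - 1# * P₁ i k) k)
    P₂r = λ r r≢i k → reflexive (set-away P₁ j (λ k → P₁ j k + - 1# * P₁ i k) r r≢i k)
    P₃i = λ k → reflexive (set-at P₂ i (λ k → P₂ i k + 1# * P₂ j k) k)
    P₃r = λ r r≢i k → reflexive (set-away P₂ i (λ k → P₂ i k + 1# * P₂ j k) r r≢i k)

    j≢i : j ≢ i
    j≢i = i≢j ∘ ≡.sym

    y-[x+y] : ∀ x y → y + - 1# * (x + 1# * y) ≈ - x
    y-[x+y] x y = begin
      y + - 1# * (x + 1# * y)     ≈⟨ +-congˡ (trans (-1*x≈-x _) (-‿cong (+-congˡ (*-identityˡ y)))) ⟩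
      y + - (x + y)               ≈⟨ +-congˡ (-‿anti-homo-+ x y) ⟩
      y + (- y + - x)             ≈⟨ +-assoc _ _ _ ⟨
      y + - y + - x               ≈⟨ +-congʳ (-‿inverseʳ y) ⟩
      0# + - x                    ≈⟨ +-identityˡ _ ⟩
      - x                         ∎

    x+y-x : ∀ x y → x + 1# * y + 1# * (y + - 1# * (x + 1# * y)) ≈ y
    x+y-x x y = begin
      x + 1# * y + 1# * (y + - 1# * (x + 1# * y))
        ≈⟨ +-cong (+-congˡ (*-identityˡ y)) (trans (*-identityˡ _) (y-[x+y] x y)) ⟩
      x + y + - x
        ≈⟨ xyx⁻¹≈y x y ⟩
      y ∎

    P₃i≈Mj : ∀ k → P₃ i k ≈ M j k
    P₃i≈Mj k = begin
      P₃ i k                 ≈⟨ P₃i k ⟩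
      P₂ i k + 1# * P₂ j k   ≈⟨ +-cong (trans (P₂r i i≢j k) (P₁i k)) (*-congˡ (trans (P₂j k)
                                  (+-cong (P₁r j j≢i k) (*-congˡ (P₁i k))))) ⟩
      _                      ≈⟨ x+y-x (M i k) (M j k) ⟩
      M j k                  ∎

    P₃j≈-Mi : ∀ k → P₃ j k ≈ - M i k
    P₃j≈-Mi k = begin
      P₃ j k                   ≈⟨ P₃r j j≢i k ⟩
      P₂ j k                   ≈⟨ P₂j k ⟩
      P₁ j k + - 1# * P₁ i k   ≈⟨ +-cong (P₁r j j≢i k) (*-congˡ (P₁i k)) ⟩
      _                        ≈⟨ y-[x+y] (M i k) (M j k) ⟩
      - M i k                  ∎

    N-row : ∀ r {s} → PC.transpose i j r ≡ s → ∀ k → N r k ≈ M s k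
    N-row r eq k = reflexive (≡.cong (λ s → M s k) eq)

    P₃≈N′ : ∀ r → Dec (r ≡ i) → r ≢ j → ∀ k → P₃ r k ≈ N r k
    P₃≈N′ r (yes ≡.refl) r≢j k = trans (P₃i≈Mj k) (sym (N-row i (transpose-fst i j) k))
    P₃≈N′ r (no  r≢i)    r≢j k = begin
      P₃ r k  ≈⟨ P₃r r r≢i k ⟩
      P₂ r k  ≈⟨ P₂r r r≢j k ⟩
      P₁ r k  ≈⟨ P₁r r r≢i k ⟩
      M r k   ≈⟨ N-row r (transpose-other r≢i r≢j) k ⟨
      N r k   ∎

    P₃≈N : ∀ r → r ≢ j → ∀ k → P₃ r k ≈ N r k
    P₃≈N r = P₃≈N′ r (r ≟ i)

    det-P₃ : det P₃ ≈ - det N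
    det-P₃ = begin
      -- Pure scaling of row `j` by -1: the second summand has coefficient 0, and `N` only fills its
      -- place.
      det P₃                       ≈⟨ det-linear j (- 1#) 0# P₃j P₃≈N P₃≈N ⟩
      - 1# * det N + 0# * det N    ≈⟨ +-cong (-1*x≈-x _) (zeroˡ _) ⟩
      - det N + 0#                 ≈⟨ +-identityʳ _ ⟩
      - det N                      ∎
      where
      P₃j : ∀ k → P₃ j k ≈ - 1# * N j k + 0# * N j k
      P₃j k = begin
        P₃ j k                        ≈⟨ P₃j≈-Mi k ⟩
        - M i k                       ≈⟨ -‿cong (N-row j (transpose-snd i≢j) k) ⟨
        - N j k                       ≈⟨ +-identityʳ _ ⟨
        - N j k + 0#                  ≈⟨ +-cong (-1*x≈-x _) (zeroˡ _) ⟨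
        - 1# * N j k + 0# * N j k     ∎

  -- The terms for deleted columns (0 , k) cancel those for (k + 1 , 0), and
  -- the remaining ones form the same sum for the columns after the first.
  double-expansion-vanishes : ∀ n (a : Vector Carrier (2 ℕ.+ n)) (H : (Fin n → Fin (2 ℕ.+ n)) → Carrier) →
    (∀ {g h} → (∀ s → g s ≡ h s) → H g ≈ H h) →
    ∑ (λ j → sign j * a j * ∑ (λ k → sign k * a (punchIn j k) * H (punchIn j ∘ punchIn k))) ≈ 0#
  double-expansion-vanishes n a H H-cong = begin
    ∑ (λ j → sign j * a j * ∑ (λ k → sign k * a (punchIn j k) * H (punchIn j ∘ punchIn k)))
      ≈⟨ ∑-suc ⟩
    1# * a zero * ∑ first + ∑ (λ j → b j * ∑ (λ k → sign k * a (punchIn (suc j) k) * H (punchIn (suc j) ∘ punchIn k)))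
      ≈⟨ +-cong (sym (∑-*ˡ _)) (∑-cong λ j → trans (*-congˡ ∑-suc) (distribˡ _ _ _)) ⟩
    ∑ (λ j → 1# * a zero * first j) + ∑ (λ j → b j * second j + b j * ∑ (third j))
      ≈⟨ +-congˡ ∑-+ ⟩
    ∑ (λ j → 1# * a zero * first j) + (∑ (λ j → b j * second j) + ∑ (λ j → b j * ∑ (third j)))
      ≈⟨ +-assoc _ _ _ ⟨
    ∑ (λ j → 1# * a zero * first j) + ∑ (λ j → b j * second j) + ∑ (λ j → b j * ∑ (third j))
      ≈⟨ +-cong (trans (sym ∑-+) (∑-zero cancel)) (rest n a H H-cong) ⟩
    0# + 0#
      ≈⟨ +-identityˡ 0# ⟩
    0# ∎
    where
    b first second : Fin (suc n) → Carrier
    b      j = sign (suc j) * a (suc j)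
    first  k = sign k * a (suc k) * H (suc ∘ punchIn k)
    second j = 1# * a zero * H (suc ∘ punchIn j)

    third : Fin (suc n) → Fin n → Carrier
    third j k = sign (suc k) * a (suc (punchIn j k)) * H (punchIn (suc j) ∘ punchIn (suc k))

    -- Both terms carry the same `H`, because `punchIn zero ∘ punchIn j` and
    -- `punchIn (suc j) ∘ punchIn zero` both compute to `suc ∘ punchIn j`; the extra -1 in
    -- `sign (suc j)` makes them opposite.
    cancel : ∀ j → 1# * a zero * first j + sign (suc j) * a (suc j) * second j ≈ 0#
    cancel j = begin
      1# * a zero * (s * x * h) + - 1# * s * x * (1# * a zero * h)
        ≈⟨ solve 6 (λ u e a s x h → u :* a :* (s :* x :* h) :+ e :* s :* x :* (u :* a :* h)
                    := (u :+ e :* u) :* (a :* s :* x :* h)) refl 1# (- 1#) (a zero) s x h ⟩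
      (1# + - 1# * 1#) * (a zero * s * x * h)
        ≈⟨ *-congʳ (trans (+-congˡ (*-identityʳ _)) (-‿inverseʳ 1#)) ⟩
      0# * (a zero * s * x * h)
        ≈⟨ zeroˡ _ ⟩
      0# ∎
      where
      s = sign j
      x = a (suc j)
      h = H (suc ∘ punchIn j)

    -- Column 0 survives every deletion here, which `lift 1` records:
    -- `punchIn (suc j) ∘ punchIn (suc k)` agrees pointwise with `lift 1 (punchIn j ∘ punchIn k)`.
    -- The two factors -1 cancel, leaving the original sum with one column fewer.
    rest : ∀ n (a : Vector Carrier (2 ℕ.+ n)) (H : (Fin n → Fin (2 ℕ.+ n)) → Carrier) → (∀ {g h} → (∀ s → g s ≡ h s) → H g ≈ H h) →
      ∑ (λ j → sign (suc j) * a (suc j) *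
        ∑ (λ k → sign (suc k) * a (suc (punchIn j k)) * H (punchIn (suc j) ∘ punchIn (suc k)))) ≈ 0#
    rest zero    a H H-cong = ∑-zero λ j → trans (*-congˡ (∑-zero λ ())) (zeroʳ _)
    rest (suc n) a H H-cong = trans (∑-cong step)
      (double-expansion-vanishes n (tail a) (H ∘ lift 1) λ eq →
        H-cong λ { zero → ≡.refl ; (suc s) → ≡.cong suc (eq s) })
      where
      step : ∀ j →
        sign (suc j) * a (suc j) *
          ∑ (λ k → sign (suc k) * a (suc (punchIn j k)) * H (punchIn (suc j) ∘ punchIn (suc k))) ≈
        sign j * a (suc j) * ∑ (λ k → sign k * a (suc (punchIn j k)) * H (lift 1 (punchIn j ∘ punchIn k)))
      step j = begin
        - 1# * sign j * a (suc j) * ∑ (λ k → - 1# * sign k * a (suc (punchIn j k)) * H (punchIn (suc j) ∘ punchIn (suc k)))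
          ≈⟨ *-congˡ (∑-cong λ k → trans (*-congʳ (*-assoc _ _ _)) (trans (*-assoc _ _ _)
               (*-congˡ (*-congˡ (H-cong λ { zero → ≡.refl ; (suc s) → ≡.refl }))))) ⟩
        - 1# * sign j * a (suc j) * ∑ (λ k → - 1# * y k)
          ≈⟨ *-congˡ (∑-*ˡ (- 1#)) ⟩
        - 1# * sign j * a (suc j) * (- 1# * ∑ y)
          ≈⟨ solve 4 (λ e s a y → e :* s :* a :* (e :* y) := (e :* e) :* (s :* a :* y)) refl (- 1#) (sign j) (a (suc j)) (∑ y) ⟩
        - 1# * - 1# * (sign j * a (suc j) * ∑ y)
          ≈⟨ *-congʳ (trans (-1*x≈-x _) (-‿involutive 1#)) ⟩
        1# * (sign j * a (suc j) * ∑ y)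
          ≈⟨ *-identityˡ _ ⟩
        sign j * a (suc j) * ∑ y ∎
        where
        y : Fin (suc n) → Carrier
        y k = sign k * a (suc (punchIn j k)) * H (lift 1 (punchIn j ∘ punchIn k))

  -- Expanding twice takes one coefficient from each of the two equal rows, and the remaining
  -- determinant depends only on which columns are left, not on the order of their deletion. The
  -- terms cancel in pairs, also in characteristic 2.
  alternating-01 : ∀ {n} → AlternatingAt {suc (suc n)} zero (suc zero)
  alternating-01 {n} M M0≈M1 = begin
    det M
      ≈⟨ det-expand M ⟩
    ∑ (λ j → sign j * M zero j * det (minor M j))
      ≈⟨ ∑-cong (λ j → *-congˡ (trans (det-expand (minor M j))
           (∑-cong λ k → *-congʳ (*-congˡ (sym (M0≈M1 (punchIn j k))))))) ⟩
    ∑ (λ j → sign j * M zero j * ∑ (λ k → sign k * M zero (punchIn j k) * H (punchIn j ∘ punchIn k)))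
      ≈⟨ double-expansion-vanishes n (M zero) H
           (λ g≗h → det-cong λ r s → reflexive (≡.cong (M (suc (suc r))) (g≗h s))) ⟩
    0# ∎
    where
    H : (Fin n → Fin (suc (suc n))) → Carrier
    H g = det λ r s → M (suc (suc r)) (g s)

  -- The row equal to the first one is swapped into second position, which reduces to
  -- `alternating-01`. The swap involves only rows below the first, so alternation one size down
  -- justifies it.
  alternating-0 : ∀ {n} → (∀ {i j : Fin n} → i ≢ j → AlternatingAt i j) →
                  ∀ (j : Fin n) → AlternatingAt zero (suc j)
  alternating-0 alt zero    = alternating-01
  alternating-0 alt (suc j) M M0≈Mj = begin
    det M            ≈⟨ -‿involutive _ ⟨
    - (- det M)      ≈⟨ -‿cong (det-swapRows {i = suc zero} {suc (suc j)} (λ ())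
                         (alternating-suc (alt λ ())) (alternating-suc (alt λ ())) M) ⟨
    - det N          ≈⟨ -‿cong (alternating-01 N M0≈Mj) ⟩
    - 0#             ≈⟨ -0#≈0# ⟩
    0#               ∎
    where
    N : Matrix Carrier _ _
    N = M ∘ PC.transpose (suc zero) (suc (suc j))

  det-alternating : ∀ {n} {i j : Fin n} → i ≢ j → AlternatingAt i j
  det-alternating {suc n} {zero}  {zero}  i≢j = contradiction ≡.refl i≢j
  det-alternating {suc n} {zero}  {suc j} i≢j = alternating-0 det-alternating j
  det-alternating {suc n} {suc i} {zero}  i≢j M Mi≈M0 = alternating-0 det-alternating i M (sym ∘ Mi≈M0)
  det-alternating {suc n} {suc i} {suc j} i≢j = alternating-suc (det-alternating (i≢j ∘ ≡.cong suc))

  -- Simultaneous row additions.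

  -- Coordinates of `d` are replaced by those of `e` one at a time. The hypothesis `F-cong` does the
  -- work of function extensionality.
  constant-if-coordinatewise : ∀ {a n} {A : Set a} (F : Vector A n → Carrier) →
    (∀ {d e} → (∀ i → d i ≡ e i) → F d ≈ F e) →
    (∀ i {d e} → (∀ r → r ≢ i → d r ≡ e r) → F d ≈ F e) →
    ∀ d e → F d ≈ F e
  constant-if-coordinatewise {n = zero}  F F-cong F-const d e = F-cong λ ()
  constant-if-coordinatewise {n = suc n} F F-cong F-const d e = begin
    F d                                  ≈⟨ F-const zero (λ { zero 0≢0 → contradiction ≡.refl 0≢0 ; (suc r) _ → ≡.refl }) ⟩
    F (e zero Vector.∷ tail d)           ≈⟨ constant-if-coordinatewise (λ x → F (e zero Vector.∷ x))
                                              (λ d≗e → F-cong λ { zero → ≡.refl ; (suc r) → d≗e r })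
                                              (λ i d≗e → F-const (suc i) λ { zero _ → ≡.refl
                                                                           ; (suc r) r≢i → d≗e r (r≢i ∘ ≡.cong suc) })
                                              (tail d) (tail e) ⟩
    F (e zero Vector.∷ tail e)           ≈⟨ F-cong (λ { zero → ≡.refl ; (suc r) → ≡.refl }) ⟩
    F e                                  ∎

  -- By c (f i) = 0 the rows that are added to others are themselves unchanged,
  -- so the additions can be made one row at a time.
  det-addRows : ∀ {n} (f : Fin n → Fin n) (c : Vector Carrier n) → (∀ i → c (f i) ≈ 0#) →
                {M N : Matrix Carrier n n} →
                (∀ i j → N i j ≈ M i j + c i * M (f i) j) →
                det N ≈ det M
  det-addRows {n} f c cf≈0 {M} {N} N≈M+cMf = begin
    det N                  ≈⟨ det-cong (λ i j → trans (N≈M+cMf i j) (+-congˡ (*-congʳ (sym (*-identityˡ (c i)))))) ⟩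
    det (P (const 1#))     ≈⟨ constant-if-coordinatewise (det ∘ P) P-cong P-const (const 1#) (const 0#) ⟩
    det (P (const 0#))     ≈⟨ det-cong (λ i j → trans (+-congˡ (trans (*-congʳ (zeroˡ (c i))) (zeroˡ _))) (+-identityʳ _)) ⟩
    det M                  ∎
    where
    -- The vector `d` says how much of each addition has been carried out: all ones give `N`, all
    -- zeros give `M`, and changing one entry is one elementary row operation.
    P : Vector Carrier n → Matrix Carrier n n
    P d i j = M i j + d i * c i * M (f i) j

    P-cong : ∀ {d e} → (∀ i → d i ≡ e i) → det (P d) ≈ det (P e)
    P-cong d≗e = det-cong λ i j → +-congˡ (*-congʳ (*-congʳ (reflexive (d≗e i))))

    P-unchanged : ∀ d {i} → c i ≈ 0# → ∀ j → P d i j ≈ M i j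
    P-unchanged d {i} ci≈0 j = begin
      M i j + d i * c i * M (f i) j   ≈⟨ +-congˡ (*-congʳ (*-congˡ ci≈0)) ⟩
      M i j + d i * 0# * M (f i) j    ≈⟨ +-congˡ (trans (*-congʳ (zeroʳ _)) (zeroˡ _)) ⟩
      M i j + 0#                      ≈⟨ +-identityʳ _ ⟩
      M i j                           ∎

    P-const : ∀ i {d e} → (∀ r → r ≢ i → d r ≡ e r) → det (P d) ≈ det (P e)
    P-const i {d} {e} d≗e with i ≟ f i
    ... | no i≢fi = sym (det-addRow i≢fi (det-alternating i≢fi) ((e i + - d i) * c i)
                          (λ k → sym (row k))
                          (λ r r≢i k → +-congˡ (*-congʳ (*-congʳ (reflexive (≡.sym (d≗e r r≢i)))))))
      where
      row : ∀ k → P d i k + (e i + - d i) * c i * P d (f i) k ≈ P e i k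
      row k = begin
        M i k + d i * c i * m + (e i + - d i) * c i * P d (f i) k  ≈⟨ +-congˡ (*-congˡ (P-unchanged d (cf≈0 i) k)) ⟩
        M i k + d i * c i * m + (e i + - d i) * c i * m
          ≈⟨ solve 6 (λ x d d′ e c m → x :+ d :* c :* m :+ (e :+ d′) :* c :* m
                                       := x :+ (e :+ (d :+ d′)) :* c :* m)
               refl (M i k) (d i) (- d i) (e i) (c i) m ⟩
        M i k + (e i + (d i + - d i)) * c i * m                    ≈⟨ +-congˡ (*-congʳ (*-congʳ
                                                                        (trans (+-congˡ (-‿inverseʳ _)) (+-identityʳ _)))) ⟩
        M i k + e i * c i * m                                      ∎
        where m = M (f i) k
    -- A row added to itself has coefficient `c i ≈ c (f i) ≈ 0#`, so the value of `d i` does not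
    -- affect the matrix.
    ... | yes i≡fi = det-cong λ r j → row r j (r ≟ i)
      where
      ci≈0 : c i ≈ 0#
      ci≈0 = trans (reflexive (≡.cong c i≡fi)) (cf≈0 i)

      row : ∀ r j → Dec (r ≡ i) → P d r j ≈ P e r j
      row r j (yes ≡.refl) = trans (P-unchanged d ci≈0 j) (sym (P-unchanged e ci≈0 j))
      row r j (no  r≢i)    = +-congˡ (*-congʳ (*-congʳ (reflexive (d≗e r r≢i))))

  -- Expanding along the first row and then along the first column treats rows
  -- and columns alike.
  det-ᵀ : ∀ {n} (M : Matrix Carrier n n) → det M ≈ det (M ᵀ)
  det-ᵀ {zero}        M = refl
  det-ᵀ {suc zero}    M = refl
  det-ᵀ {suc (suc n)} M = begin
    det M
      ≈⟨ expand₂ det-ᵀ M ⟩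
    M zero zero * det (λ r s → M (suc r) (suc s)) + ∑ (λ j → ∑ λ i → term M j i)
      ≈⟨ +-cong (*-congˡ (det-ᵀ (minor M zero))) ∑-swap ⟩
    M zero zero * det (λ r s → M (suc s) (suc r)) + ∑ (λ i → ∑ λ j → term M j i)
      ≈⟨ +-congˡ (∑-cong λ i → ∑-cong λ j → *-cong
           (solve 4 (λ s t x y → s :* t :* x :* y := t :* s :* y :* x) refl (sign j) (sign i) (M zero (suc j)) (M (suc i) zero))
           (-‿cong (det-ᵀ (λ r s → M (suc (punchIn i s)) (suc (punchIn j r)))))) ⟩
    M zero zero * det (λ r s → M (suc s) (suc r)) + ∑ (λ i → ∑ λ j → term (M ᵀ) i j)
      ≈⟨ expand₂ det-ᵀ (M ᵀ) ⟨
    det (M ᵀ) ∎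
    where
    -- The -1 left over from `sign (suc j)` is attached to the inner determinant, so that the other
    -- four factors merely trade places when `M` is transposed and `i`, `j` are exchanged.
    term : Matrix Carrier (suc (suc n)) (suc (suc n)) → Fin (suc n) → Fin (suc n) → Carrier
    term M j i = sign j * sign i * M zero (suc j) * M (suc i) zero
                 * - det (λ r s → M (suc (punchIn i s)) (suc (punchIn j r)))

    -- The first column of a minor is reached by transposing that minor, which is the induction
    -- hypothesis one size down; it is an argument because both `M` and `M ᵀ` are expanded.
    expand₂ : (∀ N → det {suc n} N ≈ det (N ᵀ)) → ∀ M →
              det M ≈ M zero zero * det (λ r s → M (suc r) (suc s)) + ∑ (λ j → ∑ λ i → term M j i)
    expand₂ det-ᵀ M = begin
      det M
        ≈⟨ trans (det-expand M) ∑-suc ⟩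
      1# * M zero zero * det (minor M zero) + ∑ (λ j → sign (suc j) * M zero (suc j) * det (minor M (suc j)))
        ≈⟨ +-cong (*-congʳ (*-identityˡ _)) (∑-cong λ j → *-congˡ
             (trans (det-ᵀ (minor M (suc j))) (det-expand (minor M (suc j) ᵀ)))) ⟩
      M zero zero * det (λ r s → M (suc r) (suc s)) + ∑ (λ j → sign (suc j) * M zero (suc j) *
        ∑ (λ i → sign i * M (suc i) zero * D i j))
        ≈⟨ +-congˡ (∑-cong λ j → trans (sym (∑-*ˡ _)) (∑-cong λ i →
             trans (solve 6 (λ e s x t y d → e :* s :* x :* (t :* y :* d) := s :* t :* x :* y :* (e :* d)) refl
                     (- 1#) (sign j) (M zero (suc j)) (sign i) (M (suc i) zero) (D i j))
                   (*-congˡ (-1*x≈-x _)))) ⟩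
      M zero zero * det (λ r s → M (suc r) (suc s)) + ∑ (λ j → ∑ λ i → term M j i) ∎
      where
      D : Fin (suc n) → Fin (suc n) → Carrier
      D i j = det λ r s → M (suc (punchIn i s)) (suc (punchIn j r))

  -- With the zero block in the upper right, expansion along the first row only meets columns of the
  -- left block, and each minor has the same shape.
  det-block : ∀ m {n} (M : Matrix Carrier (m ℕ.+ n) (m ℕ.+ n)) →
              (∀ i j → M (i ↑ˡ n) (m ↑ʳ j) ≈ 0#) →
              det M ≈ det (λ i j → M (i ↑ˡ n) (j ↑ˡ n)) * det (λ i j → M (m ↑ʳ i) (m ↑ʳ j))
  det-block zero        M M₁₂≈0 = sym (*-identityˡ _)
  det-block (suc m) {n} M M₁₂≈0 = begin
    det M
      ≈⟨ trans (det-expand M) (∑-↑ (suc m)) ⟩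
    ∑ (λ j → sign (j ↑ˡ n) * M zero (j ↑ˡ n) * det (minor M (j ↑ˡ n)))
      + ∑ (λ j → sign (suc m ↑ʳ j) * M zero (suc m ↑ʳ j) * det (minor M (suc m ↑ʳ j)))
      ≈⟨ +-cong (∑-cong step) (∑-zero λ j → trans (*-congʳ (trans (*-congˡ (M₁₂≈0 zero j)) (zeroʳ _))) (zeroˡ _)) ⟩
    ∑ (λ j → sign j * M₁₁ zero j * det (minor M₁₁ j) * det M₂₂) + 0#
      ≈⟨ trans (+-identityʳ _) (∑-*ʳ _) ⟩
    ∑ (λ j → sign j * M₁₁ zero j * det (minor M₁₁ j)) * det M₂₂
      ≈⟨ *-congʳ (det-expand M₁₁) ⟨
    det M₁₁ * det M₂₂ ∎
    where
    M₁₁ : Matrix Carrier (suc m) (suc m)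
    M₁₁ i j = M (i ↑ˡ n) (j ↑ˡ n)

    M₂₂ : Matrix Carrier n n
    M₂₂ i j = M (suc m ↑ʳ i) (suc m ↑ʳ j)

    step : ∀ j → sign (j ↑ˡ n) * M zero (j ↑ˡ n) * det (minor M (j ↑ˡ n)) ≈
                 sign j * M₁₁ zero j * det (minor M₁₁ j) * det M₂₂
    step j = begin
      sign (j ↑ˡ n) * M zero (j ↑ˡ n) * det (minor M (j ↑ˡ n))
        ≈⟨ *-cong (*-congʳ (reflexive (≡.cong ((- 1#) ^_) (toℕ-↑ˡ j n))))
             (det-block m (minor M (j ↑ˡ n)) λ i k →
               trans (reflexive (≡.cong (M (suc (i ↑ˡ n))) (punchIn-↑ˡ-↑ʳ m j k))) (M₁₂≈0 (suc i) k)) ⟩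
      sign j * M₁₁ zero j * (det (λ r s → M (suc (r ↑ˡ n)) (punchIn (j ↑ˡ n) (s ↑ˡ n))) *
                             det (λ r s → M (suc m ↑ʳ r) (punchIn (j ↑ˡ n) (m ↑ʳ s))))
        ≈⟨ *-congˡ (*-cong (det-cong λ r s → reflexive (≡.cong (M (suc (r ↑ˡ n))) (punchIn-↑ˡ-↑ˡ n j s)))
                           (det-cong λ r s → reflexive (≡.cong (M (suc m ↑ʳ r)) (punchIn-↑ˡ-↑ʳ m j s)))) ⟩
      sign j * M₁₁ zero j * (det (minor M₁₁ j) * det M₂₂)
        ≈⟨ *-assoc _ _ _ ⟨
      sign j * M₁₁ zero j * det (minor M₁₁ j) * det M₂₂ ∎

  -- Simultaneous permutations, and determinants over arbitrary finite index types.

  det-transpose² : ∀ {n} (i j : Fin n) (M : Matrix Carrier n n) →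
                   det (λ r s → M (PC.transpose i j r) (PC.transpose i j s)) ≈ det M
  det-transpose² i j M with i ≟ j
  -- A `TranspositionList` may contain trivial pairs `(i , i)`, to which the sign rule for swaps
  -- does not apply.
  ... | yes ≡.refl = det-cong λ r s → reflexive (≡.cong₂ M (transpose-same i r) (transpose-same i s))
  ... | no  i≢j    = begin
    det (λ r s → M (t r) (t s))     ≈⟨ det-swapRows i≢j alt alt′ (λ r s → M r (t s)) ⟩
    - det (λ r s → M r (t s))       ≈⟨ -‿cong (det-ᵀ (λ r s → M r (t s))) ⟩
    - det ((M ᵀ) ∘ t)               ≈⟨ -‿cong (det-swapRows i≢j alt alt′ (M ᵀ)) ⟩
    - - det (M ᵀ)                   ≈⟨ -‿involutive _ ⟩
    det (M ᵀ)                       ≈⟨ det-ᵀ M ⟨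
    det M                           ∎
    where
    t    = PC.transpose i j
    alt  = det-alternating i≢j
    alt′ = det-alternating (i≢j ∘ ≡.sym)

  det-eval : ∀ {n} (ts : TranspositionList n) (M : Matrix Carrier n n) →
             det (λ r s → M (eval ts Perm.⟨$⟩ʳ r) (eval ts Perm.⟨$⟩ʳ s)) ≈ det M
  det-eval []             M = refl
  det-eval ((i , j) ∷ ts) M = trans (det-transpose² i j _) (det-eval ts M)

  -- The sizes are kept apart because regrouping blocks yields sizes such as `p + (q + q)` and
  -- `q + (p + q)`, which are equal but not by computation.
  det-permute : ∀ {m n} (π : Perm.Permutation m n) (M : Matrix Carrier n n) →
                det (λ r s → M (π Perm.⟨$⟩ʳ r) (π Perm.⟨$⟩ʳ s)) ≈ det M
  det-permute π M with ≡.refl ← Perm.↔⇒≡ π = trans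
    (det-cong λ r s → reflexive (≡.sym (≡.cong₂ M (eval-decompose π r) (eval-decompose π s))))
    (det-eval (decompose π) M)

  -- By `detOn-unique` the value is independent of the enumeration. Block arguments can thus be made
  -- by cases on sum types, in whichever order of blocks is convenient.
  detOn : ∀ {n} {I : Set} → Fin n ↔ I → (I → I → Carrier) → Carrier
  detOn e M = det λ i j → M (Inverse.to e i) (Inverse.to e j)

  detOn-cong : ∀ {n} {I : Set} (e : Fin n ↔ I) {M N : I → I → Carrier} →
               (∀ i j → M i j ≈ N i j) → detOn e M ≈ detOn e N
  detOn-cong e M≈N = det-cong λ i j → M≈N (Inverse.to e i) (Inverse.to e j)

  detOn-from : ∀ {n} {I : Set} (e : Fin n ↔ I) (M : Matrix Carrier n n) →
               detOn e (λ i j → M (Inverse.from e i) (Inverse.from e j)) ≈ det M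
  detOn-from e M = det-cong λ i j →
    reflexive (≡.cong₂ M (Inverse.strictlyInverseʳ e i) (Inverse.strictlyInverseʳ e j))

  detOn-unique : ∀ {m n} {I : Set} (e : Fin m ↔ I) (e′ : Fin n ↔ I) (M : I → I → Carrier) →
                 detOn e M ≈ detOn e′ M
  detOn-unique e e′ M = trans
    (det-cong λ i j → reflexive (≡.sym (≡.cong₂ M
      (Inverse.strictlyInverseˡ e′ (Inverse.to e i)) (Inverse.strictlyInverseˡ e′ (Inverse.to e j)))))
    (det-permute (↔-sym e′ ↔-∘ e) (λ i j → M (Inverse.to e′ i) (Inverse.to e′ j)))

  detOn-addRows : ∀ {n} {I : Set} (e : Fin n ↔ I) (f : I → I) (c : I → Carrier) →
                  (∀ i → c (f i) ≈ 0#) → (M N : I → I → Carrier) →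
                  (∀ i j → N i j ≈ M i j + c i * M (f i) j) →
                  detOn e N ≈ detOn e M
  detOn-addRows e f c cf≈0 M N N≈M+cMf = det-addRows (from ∘ f ∘ to) (c ∘ to)
    (λ i → trans (reflexive (≡.cong c (strictlyInverseˡ _))) (cf≈0 (to i)))
    (λ i j → trans (N≈M+cMf (to i) (to j))
      (+-congˡ (*-congˡ (reflexive (≡.cong (λ k → M k (to j)) (≡.sym (strictlyInverseˡ _)))))))
    where open Inverse e

  detOn-addColumns : ∀ {n} {I : Set} (e : Fin n ↔ I) (f : I → I) (c : I → Carrier) →
                     (∀ i → c (f i) ≈ 0#) → (M N : I → I → Carrier) →
                     (∀ i j → N i j ≈ M i j + c j * M i (f j)) →
                     detOn e N ≈ detOn e M
  detOn-addColumns e f c cf≈0 M N N≈M+cMf = begin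
    detOn e N                   ≈⟨ det-ᵀ (λ i j → N (to i) (to j)) ⟩
    detOn e (λ i j → N j i)     ≈⟨ detOn-addRows e f c cf≈0 (λ i j → M j i) (λ i j → N j i) (λ i j → N≈M+cMf j i) ⟩
    detOn e (λ i j → M j i)     ≈⟨ det-ᵀ (λ i j → M (to i) (to j)) ⟨
    detOn e M                   ∎
    where open Inverse e

  detOn-block : ∀ {l m n} {I J : Set} (e : Fin l ↔ (I ⊎ J)) (e₁ : Fin m ↔ I) (e₂ : Fin n ↔ J)
                (M : I ⊎ J → I ⊎ J → Carrier) → (∀ i j → M (inj₁ i) (inj₂ j) ≈ 0#) →
                detOn e M ≈ detOn e₁ (λ i j → M (inj₁ i) (inj₁ j)) * detOn e₂ (λ i j → M (inj₂ i) (inj₂ j))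
  detOn-block {m = m} {n} e e₁ e₂ M M₁₂≈0 = begin
    detOn e M
      ≈⟨ detOn-unique e e₁₂ M ⟩
    detOn e₁₂ M
      ≈⟨ det-block m _ (λ i j → trans (reflexive (≡.cong₂ M (to-↑ˡ i) (to-↑ʳ j))) (M₁₂≈0 _ _)) ⟩
    det (λ i j → M (to (i ↑ˡ n)) (to (j ↑ˡ n))) * det (λ i j → M (to (m ↑ʳ i)) (to (m ↑ʳ j)))
      ≈⟨ *-cong (det-cong λ i j → reflexive (≡.cong₂ M (to-↑ˡ i) (to-↑ˡ j)))
                (det-cong λ i j → reflexive (≡.cong₂ M (to-↑ʳ i) (to-↑ʳ j))) ⟩
    detOn e₁ (λ i j → M (inj₁ i) (inj₁ j)) * detOn e₂ (λ i j → M (inj₂ i) (inj₂ j)) ∎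
    where
    e₁₂ = (e₁ ⊎-↔ e₂) ↔-∘ +↔⊎
    open Inverse e₁₂ using (to)

    to-↑ˡ : ∀ i → to (i ↑ˡ n) ≡ inj₁ (Inverse.to e₁ i)
    to-↑ˡ i = ≡.cong (Inverse.to (e₁ ⊎-↔ e₂)) (splitAt-↑ˡ m i n)

    to-↑ʳ : ∀ j → to (m ↑ʳ j) ≡ inj₂ (Inverse.to e₂ j)
    to-↑ʳ j = ≡.cong (Inverse.to (e₁ ⊎-↔ e₂)) (splitAt-↑ʳ m n j)

  -- Block matrices indexed by sums.

  block : ∀ {I J : Set} → (I → I → Carrier) → (I → J → Carrier) → (J → I → Carrier) → (J → J → Carrier) →
          I ⊎ J → I ⊎ J → Carrier
  block X Y Z W (inj₁ i) (inj₁ j) = X i j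
  block X Y Z W (inj₁ i) (inj₂ j) = Y i j
  block X Y Z W (inj₂ i) (inj₁ j) = Z i j
  block X Y Z W (inj₂ i) (inj₂ j) = W i j

  -- Transposition sends `Y` to the lower left, and interchanging the summands brings it back to the
  -- upper right. So `Y` and `Z` keep their positions while `X` and `W` trade theirs; this keeps the
  -- block 2B in its corner.
  detOn-block-flip : ∀ {m n} {I J : Set} (e : Fin m ↔ (I ⊎ J)) (e′ : Fin n ↔ (J ⊎ I)) {X Y Z W} →
                     detOn e (block X Y Z W) ≈ detOn e′ (block (λ i j → W j i) (λ i j → Y j i) (λ i j → Z j i) (λ i j → X j i))
  detOn-block-flip {I = I} {J} e e′ {X} {Y} {Z} {W} = begin
    detOn e (block X Y Z W)
      ≈⟨ det-ᵀ (λ i j → block X Y Z W (Inverse.to e i) (Inverse.to e j)) ⟩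
    detOn e (λ i j → block X Y Z W j i)
      ≈⟨ detOn-unique e (⊎-comm J I ↔-∘ e′) (λ i j → block X Y Z W j i) ⟩
    detOn e′ (λ i j → block X Y Z W (swap j) (swap i))
      ≈⟨ detOn-cong e′ flip-block ⟩
    detOn e′ (block (λ i j → W j i) (λ i j → Y j i) (λ i j → Z j i) (λ i j → X j i)) ∎
    where
    flip-block : ∀ i j → block X Y Z W (swap j) (swap i) ≈
                         block (λ i j → W j i) (λ i j → Y j i) (λ i j → Z j i) (λ i j → X j i) i j
    flip-block (inj₁ i) (inj₁ j) = refl
    flip-block (inj₁ i) (inj₂ j) = refl
    flip-block (inj₂ i) (inj₁ j) = refl
    flip-block (inj₂ i) (inj₂ j) = refl

  -- The block matrix with rows (X Y Y), (Z T W), (Z W T); its third block of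
  -- rows and columns is indexed by the left summand.
  doubled : ∀ {I J : Set} → (I → I → Carrier) → (I → J → Carrier) → (J → I → Carrier) → (T W : J → J → Carrier) →
            J ⊎ (I ⊎ J) → J ⊎ (I ⊎ J) → Carrier
  doubled X Y Z T W (inj₁ i)        (inj₁ j)        = T i j
  doubled X Y Z T W (inj₁ i)        (inj₂ (inj₁ j)) = Z i j
  doubled X Y Z T W (inj₁ i)        (inj₂ (inj₂ j)) = W i j
  doubled X Y Z T W (inj₂ (inj₁ i)) (inj₁ j)        = Y i j
  doubled X Y Z T W (inj₂ (inj₂ i)) (inj₁ j)        = W i j
  doubled X Y Z T W (inj₂ i)        (inj₂ j)        = block X Y Z T i j

  -- Subtract the second block of rows from the third, then add the third block
  -- of columns to the second: the third block of rows becomes (0 0 T-W).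
  detOn-doubled : ∀ {l m n} {I J : Set} (e : Fin l ↔ (J ⊎ (I ⊎ J))) (e₁ : Fin m ↔ J) (e₂ : Fin n ↔ (I ⊎ J))
                  {X : I → I → Carrier} {Y : I → J → Carrier} {Z : J → I → Carrier} {T W : J → J → Carrier} →
                  detOn e (doubled X Y Z T W) ≈
                  detOn e₁ (λ i j → T i j - W i j) *
                  detOn e₂ (block X (λ i j → Y i j + Y i j) Z (λ i j → T i j + W i j))
  detOn-doubled {I = I} {J} e e₁ e₂ {X} {Y} {Z} {T} {W} = begin
    detOn e D
      ≈⟨ detOn-addRows e f c cf≈0 D N (λ i j → refl) ⟨
    detOn e N
      ≈⟨ detOn-addColumns e f′ c′ c′f′≈0 N P (λ i j → refl) ⟨
    detOn e P
      -- Because the third block is indexed by the left summand, its zeros lie in the upper right,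
      -- as `detOn-block` demands.
      ≈⟨ detOn-block e e₁ e₂ P P₁₂≈0 ⟩
    detOn e₁ (λ i j → P (inj₁ i) (inj₁ j)) * detOn e₂ (λ i j → P (inj₂ i) (inj₂ j))
      ≈⟨ *-cong (detOn-cong e₁ P₁₁) (detOn-cong e₂ P₂₂) ⟩
    detOn e₁ (λ i j → T i j - W i j) * detOn e₂ (block X (λ i j → Y i j + Y i j) Z (λ i j → T i j + W i j)) ∎
    where
    D N P : J ⊎ (I ⊎ J) → J ⊎ (I ⊎ J) → Carrier
    f f′ : J ⊎ (I ⊎ J) → J ⊎ (I ⊎ J)
    c c′ : J ⊎ (I ⊎ J) → Carrier

    D = doubled X Y Z T W

    -- Rows outside the third block are sent to themselves with coefficient 0; hence `c` vanishes on
    -- every value of `f`.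
    f (inj₁ j) = inj₂ (inj₂ j)
    f (inj₂ i) = inj₂ i

    c (inj₁ j) = - 1#
    c (inj₂ i) = 0#

    N i j = D i j + c i * D (f i) j

    f′ (inj₁ j)        = inj₁ j
    f′ (inj₂ (inj₁ i)) = inj₂ (inj₁ i)
    f′ (inj₂ (inj₂ j)) = inj₁ j

    c′ (inj₁ j)        = 0#
    c′ (inj₂ (inj₁ i)) = 0#
    c′ (inj₂ (inj₂ j)) = 1#

    P i j = N i j + c′ j * N i (f′ j)

    cf≈0 : ∀ i → c (f i) ≈ 0#
    cf≈0 (inj₁ j) = refl
    cf≈0 (inj₂ i) = refl

    c′f′≈0 : ∀ i → c′ (f′ i) ≈ 0#
    c′f′≈0 (inj₁ j)        = refl
    c′f′≈0 (inj₂ (inj₁ i)) = refl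
    c′f′≈0 (inj₂ (inj₂ j)) = refl

    unchanged : ∀ x y → x + 0# * y ≈ x
    unchanged x y = trans (+-congˡ (zeroˡ y)) (+-identityʳ x)

    x-x : ∀ x → x + - 1# * x ≈ 0#
    x-x x = trans (+-congˡ (-1*x≈-x x)) (-‿inverseʳ x)

    P₁₂≈0 : ∀ i j → P (inj₁ i) (inj₂ j) ≈ 0#
    P₁₂≈0 i (inj₁ j) = trans (unchanged _ _) (x-x (Z i j))
    -- The row subtraction leaves W - T here and T - W in the third block of columns, so adding that
    -- block gives zero.
    P₁₂≈0 i (inj₂ j) = begin
      W i j + - 1# * T i j + 1# * (T i j + - 1# * W i j)
        ≈⟨ solve 4 (λ u e t w → w :+ e :* t :+ u :* (t :+ e :* w) := (u :* t :+ e :* t) :+ (w :+ u :* (e :* w)))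
             refl 1# (- 1#) (T i j) (W i j) ⟩
      (1# * T i j + - 1# * T i j) + (W i j + 1# * (- 1# * W i j))
        ≈⟨ +-cong (trans (+-congʳ (*-identityˡ _)) (x-x _)) (trans (+-congˡ (*-identityˡ _)) (x-x _)) ⟩
      0# + 0#
        ≈⟨ +-identityˡ 0# ⟩
      0# ∎

    P₁₁ : ∀ i j → P (inj₁ i) (inj₁ j) ≈ T i j - W i j
    P₁₁ i j = trans (unchanged _ _) (+-congˡ (-1*x≈-x _))

    P₂₂ : ∀ i j → P (inj₂ i) (inj₂ j) ≈
                  block X (λ i j → Y i j + Y i j) Z (λ i j → T i j + W i j) i j
    P₂₂ (inj₁ i) (inj₁ j) = trans (unchanged _ _) (unchanged _ _)
    P₂₂ (inj₂ i) (inj₁ j) = trans (unchanged _ _) (unchanged _ _)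
    P₂₂ (inj₁ i) (inj₂ j) = +-cong (unchanged _ _) (trans (*-identityˡ _) (unchanged _ _))
    P₂₂ (inj₂ i) (inj₂ j) = +-cong (unchanged _ _) (trans (*-identityˡ _) (unchanged _ _))

-- The ring of polynomials

module Polynomial {c ℓ} (R : CommutativeRing c ℓ) where
  open CommutativeRing R hiding (zero; rawRing)
  open RingDefs (CommutativeRing.rawRing R)
  open import Algebra.Properties.Ring ring using (-0#≈0#)

  infix  4 _≃_
  infixr 7 _·_

  -- _≈ᴾ_ as a record, so that f and g can be inferred from f ≃ g.
  record _≃_ (f g : Poly) : Set ℓ where
    constructor equal
    field coeffs : f ≈ᴾ g

  open _≃_

  _·_ : Carrier → Poly → Poly
  x · f = List.map (x *_) f

  -- Since `_≈ᴾ_` compares coefficients, the additive and scalar laws follow from those of the ring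
  -- regardless of trailing zeros.
  coeff-+ : ∀ f g i → coeff (f +ᴾ g) i ≈ coeff f i + coeff g i
  coeff-+ []      g       i       = sym (+-identityˡ _)
  coeff-+ (x ∷ f) []      i       = sym (+-identityʳ _)
  coeff-+ (x ∷ f) (y ∷ g) zero    = refl
  coeff-+ (x ∷ f) (y ∷ g) (suc i) = coeff-+ f g i

  coeff-· : ∀ x f i → coeff (x · f) i ≈ x * coeff f i
  coeff-· x []      i       = sym (zeroʳ x)
  coeff-· x (y ∷ f) zero    = refl
  coeff-· x (y ∷ f) (suc i) = coeff-· x f i

  coeff-neg : ∀ f i → coeff (-ᴾ f) i ≈ - coeff f i
  coeff-neg []      i       = sym -0#≈0#
  coeff-neg (y ∷ f) zero    = refl
  coeff-neg (y ∷ f) (suc i) = coeff-neg f i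

  ≃-isEquivalence : IsEquivalence _≃_
  ≃-isEquivalence = record
    { refl  = equal λ i → refl
    ; sym   = λ (equal f≈g) → equal λ i → sym (f≈g i)
    ; trans = λ (equal f≈g) (equal g≈h) → equal λ i → trans (f≈g i) (g≈h i)
    }

  open IsEquivalence ≃-isEquivalence using () renaming (refl to ≃-refl; sym to ≃-sym; trans to ≃-trans)

  ∷-cong : ∀ {x y f g} → x ≈ y → f ≃ g → x ∷ f ≃ y ∷ g
  ∷-cong x≈y (equal f≈g) = equal λ { zero → x≈y ; (suc i) → f≈g i }

  +ᴾ-cong : ∀ {f f′ g g′} → f ≃ f′ → g ≃ g′ → f +ᴾ g ≃ f′ +ᴾ g′
  +ᴾ-cong {f} {f′} {g} {g′} (equal f≈f′) (equal g≈g′) = equal λ i →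
    trans (coeff-+ f g i) (trans (+-cong (f≈f′ i) (g≈g′ i)) (sym (coeff-+ f′ g′ i)))

  +ᴾ-assoc : ∀ f g h → (f +ᴾ g) +ᴾ h ≃ f +ᴾ (g +ᴾ h)
  +ᴾ-assoc f g h = equal λ i →
    trans (trans (coeff-+ (f +ᴾ g) h i) (+-congʳ (coeff-+ f g i)))
      (trans (+-assoc _ _ _) (sym (trans (coeff-+ f (g +ᴾ h) i) (+-congˡ (coeff-+ g h i)))))

  +ᴾ-comm : ∀ f g → f +ᴾ g ≃ g +ᴾ f
  +ᴾ-comm f g = equal λ i → trans (coeff-+ f g i) (trans (+-comm _ _) (sym (coeff-+ g f i)))

  +ᴾ-identityʳ : ∀ f → f +ᴾ [] ≃ f
  +ᴾ-identityʳ f = equal λ i → trans (coeff-+ f [] i) (+-identityʳ _)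

  -ᴾ-cong : ∀ {f g} → f ≃ g → -ᴾ f ≃ -ᴾ g
  -ᴾ-cong {f} {g} (equal f≈g) = equal λ i →
    trans (coeff-neg f i) (trans (-‿cong (f≈g i)) (sym (coeff-neg g i)))

  -ᴾ-inverseʳ : ∀ f → f +ᴾ -ᴾ f ≃ []
  -ᴾ-inverseʳ f = equal λ i →
    trans (coeff-+ f (-ᴾ f) i) (trans (+-congˡ (coeff-neg f i)) (-‿inverseʳ _))

  -ᴾ-inverseˡ : ∀ f → -ᴾ f +ᴾ f ≃ []
  -ᴾ-inverseˡ f = ≃-trans (+ᴾ-comm (-ᴾ f) f) (-ᴾ-inverseʳ f)

  +ᴾ-abelianGroup : AbelianGroup c ℓ
  +ᴾ-abelianGroup = record
    { isAbelianGroup = record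
      { isGroup = record
        { isMonoid = record
          { isSemigroup = record
            { isMagma = record { isEquivalence = ≃-isEquivalence ; ∙-cong = +ᴾ-cong }
            ; assoc   = +ᴾ-assoc
            }
          ; identity = (λ f → ≃-refl) , +ᴾ-identityʳ
          }
        ; inverse = -ᴾ-inverseˡ , -ᴾ-inverseʳ
        ; ⁻¹-cong = -ᴾ-cong
        }
      ; comm = +ᴾ-comm
      }
    }

  open import Relation.Binary.Reasoning.Setoid (AbelianGroup.setoid +ᴾ-abelianGroup)
  open import Algebra.Properties.CommutativeSemigroup (AbelianGroup.commutativeSemigroup +ᴾ-abelianGroup)
    using (interchange; x∙yz≈y∙xz)

  ·-cong : ∀ {x y f g} → x ≈ y → f ≃ g → x · f ≃ y · g
  ·-cong {x} {y} {f} {g} x≈y (equal f≈g) = equal λ i →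
    trans (coeff-· x f i) (trans (*-cong x≈y (f≈g i)) (sym (coeff-· y g i)))

  ·-distribˡ : ∀ x f g → x · (f +ᴾ g) ≃ x · f +ᴾ x · g
  ·-distribˡ x f g = equal λ i → trans
    (trans (coeff-· x (f +ᴾ g) i) (trans (*-congˡ (coeff-+ f g i)) (distribˡ x _ _)))
    (sym (trans (coeff-+ (x · f) (x · g) i) (+-cong (coeff-· x f i) (coeff-· x g i))))

  ·-distribʳ : ∀ f x y → (x + y) · f ≃ x · f +ᴾ y · f
  ·-distribʳ f x y = equal λ i → trans
    (trans (coeff-· (x + y) f i) (distribʳ _ x y))
    (sym (trans (coeff-+ (x · f) (y · f) i) (+-cong (coeff-· x f i) (coeff-· y f i))))

  ·-assoc : ∀ x y f → (x * y) · f ≃ x · y · f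
  ·-assoc x y f = equal λ i → trans
    (trans (coeff-· (x * y) f i) (*-assoc x y _))
    (sym (trans (coeff-· x (y · f) i) (*-congˡ (coeff-· y f i))))

  1·f≃f : ∀ f → 1# · f ≃ f
  1·f≃f f = equal λ i → trans (coeff-· 1# f i) (*-identityˡ _)

  0·f≃[] : ∀ f → 0# · f ≃ []
  0·f≃[] f = equal λ i → trans (coeff-· 0# f i) (zeroˡ _)

  0∷[]≃[] : 0# ∷ [] ≃ []
  0∷[]≃[] = equal λ { zero → refl ; (suc i) → refl }

  0∷-+ᴾ : ∀ f g → 0# ∷ (f +ᴾ g) ≃ (0# ∷ f) +ᴾ (0# ∷ g)
  0∷-+ᴾ f g = ∷-cong (sym (+-identityˡ 0#)) ≃-refl

  *ᴾ-zeroʳ : ∀ f → f *ᴾ [] ≃ []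
  *ᴾ-zeroʳ []      = ≃-refl
  *ᴾ-zeroʳ (x ∷ f) = ≃-trans (∷-cong refl (*ᴾ-zeroʳ f)) 0∷[]≃[]

  *ᴾ-congˡ : ∀ f {g g′} → g ≃ g′ → f *ᴾ g ≃ f *ᴾ g′
  *ᴾ-congˡ []      g≃g′ = ≃-refl
  *ᴾ-congˡ (x ∷ f) g≃g′ = +ᴾ-cong (·-cong refl g≃g′) (∷-cong refl (*ᴾ-congˡ f g≃g′))

  -- The defining recursion of `_*ᴾ_` mirrored to the right factor; commutativity follows from it by
  -- induction.
  *ᴾ-∷ : ∀ f y g → f *ᴾ (y ∷ g) ≃ y · f +ᴾ (0# ∷ f *ᴾ g)
  *ᴾ-∷ []      y g = ≃-sym 0∷[]≃[]
  *ᴾ-∷ (x ∷ f) y g = ∷-cong (+-congʳ (*-comm x y)) (begin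
    x · g +ᴾ f *ᴾ (y ∷ g)                  ≈⟨ +ᴾ-cong ≃-refl (*ᴾ-∷ f y g) ⟩
    x · g +ᴾ (y · f +ᴾ (0# ∷ f *ᴾ g))      ≈⟨ x∙yz≈y∙xz (x · g) (y · f) _ ⟩
    y · f +ᴾ (x · g +ᴾ (0# ∷ f *ᴾ g))      ∎)

  *ᴾ-comm : ∀ f g → f *ᴾ g ≃ g *ᴾ f
  *ᴾ-comm []      g = ≃-sym (*ᴾ-zeroʳ g)
  *ᴾ-comm (x ∷ f) g = begin
    x · g +ᴾ (0# ∷ f *ᴾ g)   ≈⟨ +ᴾ-cong ≃-refl (∷-cong refl (*ᴾ-comm f g)) ⟩
    x · g +ᴾ (0# ∷ g *ᴾ f)   ≈⟨ *ᴾ-∷ g x f ⟨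
    g *ᴾ (x ∷ f)             ∎

  -- Equal left factors may be lists of different lengths, which obstructs a direct recursion on
  -- both; commutativity turns the left factor into a right one.
  *ᴾ-cong : ∀ {f f′ g g′} → f ≃ f′ → g ≃ g′ → f *ᴾ g ≃ f′ *ᴾ g′
  *ᴾ-cong {f} {f′} {g} {g′} f≃f′ g≃g′ = begin
    f *ᴾ g    ≈⟨ *ᴾ-congˡ f g≃g′ ⟩
    f *ᴾ g′   ≈⟨ *ᴾ-comm f g′ ⟩
    g′ *ᴾ f   ≈⟨ *ᴾ-congˡ g′ f≃f′ ⟩
    g′ *ᴾ f′  ≈⟨ *ᴾ-comm g′ f′ ⟩
    f′ *ᴾ g′  ∎

  *ᴾ-distribʳ : ∀ h f g → (f +ᴾ g) *ᴾ h ≃ f *ᴾ h +ᴾ g *ᴾ h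
  *ᴾ-distribʳ h []      g       = ≃-refl
  *ᴾ-distribʳ h (x ∷ f) []      = ≃-sym (+ᴾ-identityʳ _)
  *ᴾ-distribʳ h (x ∷ f) (y ∷ g) = begin
    (x + y) · h +ᴾ (0# ∷ (f +ᴾ g) *ᴾ h)
      ≈⟨ +ᴾ-cong (·-distribʳ h x y)
           (≃-trans (∷-cong refl (*ᴾ-distribʳ h f g)) (0∷-+ᴾ (f *ᴾ h) (g *ᴾ h))) ⟩
    (x · h +ᴾ y · h) +ᴾ ((0# ∷ f *ᴾ h) +ᴾ (0# ∷ g *ᴾ h))
      ≈⟨ interchange (x · h) (y · h) _ _ ⟩
    (x · h +ᴾ (0# ∷ f *ᴾ h)) +ᴾ (y · h +ᴾ (0# ∷ g *ᴾ h)) ∎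

  *ᴾ-distribˡ : ∀ f g h → f *ᴾ (g +ᴾ h) ≃ f *ᴾ g +ᴾ f *ᴾ h
  *ᴾ-distribˡ f g h = begin
    f *ᴾ (g +ᴾ h)        ≈⟨ *ᴾ-comm f (g +ᴾ h) ⟩
    (g +ᴾ h) *ᴾ f        ≈⟨ *ᴾ-distribʳ f g h ⟩
    g *ᴾ f +ᴾ h *ᴾ f     ≈⟨ +ᴾ-cong (*ᴾ-comm g f) (*ᴾ-comm h f) ⟩
    f *ᴾ g +ᴾ f *ᴾ h     ∎

  ·-*ᴾ : ∀ x f g → (x · f) *ᴾ g ≃ x · (f *ᴾ g)
  ·-*ᴾ x []      g = ≃-refl
  ·-*ᴾ x (y ∷ f) g = begin
    (x * y) · g +ᴾ (0# ∷ (x · f) *ᴾ g)   ≈⟨ +ᴾ-cong (·-assoc x y g) (∷-cong (sym (zeroʳ x)) (·-*ᴾ x f g)) ⟩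
    x · y · g +ᴾ x · (0# ∷ f *ᴾ g)       ≈⟨ ·-distribˡ x (y · g) (0# ∷ f *ᴾ g) ⟨
    x · (y · g +ᴾ (0# ∷ f *ᴾ g))         ∎

  *ᴾ-assoc : ∀ f g h → (f *ᴾ g) *ᴾ h ≃ f *ᴾ (g *ᴾ h)
  *ᴾ-assoc []      g h = ≃-refl
  *ᴾ-assoc (x ∷ f) g h = begin
    (x · g +ᴾ (0# ∷ f *ᴾ g)) *ᴾ h                       ≈⟨ *ᴾ-distribʳ h (x · g) (0# ∷ f *ᴾ g) ⟩
    (x · g) *ᴾ h +ᴾ (0# · h +ᴾ (0# ∷ (f *ᴾ g) *ᴾ h))    ≈⟨ +ᴾ-cong (·-*ᴾ x g h)
                                                             (+ᴾ-cong (0·f≃[] h) (∷-cong refl (*ᴾ-assoc f g h))) ⟩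
    x · (g *ᴾ h) +ᴾ (0# ∷ f *ᴾ (g *ᴾ h))                ∎

  *ᴾ-identityˡ : ∀ f → (1# ∷ []) *ᴾ f ≃ f
  *ᴾ-identityˡ f = begin
    1# · f +ᴾ (0# ∷ [])   ≈⟨ +ᴾ-cong (1·f≃f f) 0∷[]≃[] ⟩
    f +ᴾ []               ≈⟨ +ᴾ-identityʳ f ⟩
    f                     ∎

  -- Built on `_≈ᴾ_` instead of `_≃_`, so that its raw ring is by computation the `polyRawRing` in
  -- which `charPoly` takes its determinant.
  polyRing : CommutativeRing c ℓ
  polyRing = record
    { Carrier = Poly ; _≈_ = _≈ᴾ_ ; _+_ = _+ᴾ_ ; _*_ = _*ᴾ_ ; -_ = -ᴾ_ ; 0# = [] ; 1# = 1# ∷ []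
    ; isCommutativeRing = record
      { isRing = record
        { +-isAbelianGroup = record
          { isGroup = record
            { isMonoid = record
              { isSemigroup = record
                { isMagma = record
                  { isEquivalence = record
                    { refl  = λ i → refl
                    ; sym   = λ f≈g i → sym (f≈g i)
                    ; trans = λ f≈g g≈h i → trans (f≈g i) (g≈h i)
                    }
                  ; ∙-cong = λ {f} {f′} {g} {g′} f≈f′ g≈g′ → coeffs (+ᴾ-cong {f} {f′} {g} {g′} (equal f≈f′) (equal g≈g′))
                  }
                ; assoc = λ f g h → coeffs (+ᴾ-assoc f g h)
                }
              ; identity = (λ f i → refl) , λ f → coeffs (+ᴾ-identityʳ f)
              }
            ; inverse = (λ f → coeffs (-ᴾ-inverseˡ f)) , λ f → coeffs (-ᴾ-inverseʳ f)
            ; ⁻¹-cong = λ {f} {g} f≈g → coeffs (-ᴾ-cong {f} {g} (equal f≈g))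
            }
          ; comm = λ f g → coeffs (+ᴾ-comm f g)
          }
        ; *-cong     = λ {f} {f′} {g} {g′} f≈f′ g≈g′ → coeffs (*ᴾ-cong {f} {f′} {g} {g′} (equal f≈f′) (equal g≈g′))
        ; *-assoc    = λ f g h → coeffs (*ᴾ-assoc f g h)
        ; *-identity = (λ f → coeffs (*ᴾ-identityˡ f))
                     , λ f → coeffs (≃-trans (*ᴾ-comm f (1# ∷ [])) (*ᴾ-identityˡ f))
        ; distrib    = (λ f g h → coeffs (*ᴾ-distribˡ f g h)) , λ f g h → coeffs (*ᴾ-distribʳ f g h)
        }
      ; *-comm = λ f g → coeffs (*ᴾ-comm f g)
      }
    }

-- Characteristic polynomials of block matrices

open import Data.Nat.Base using (_+_)

-- Here `s` is the factor χ(S), `a` and `b` are χ(-G) and χ(-G′), and `c` and `d` are χ(G′) and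
-- χ(G).
exchange : ∀ {r ℓ} (R : CommutativeRing r ℓ) → let open CommutativeRing R in
           ∀ a s b c d → (a * s) * ((b * c) * d) ≈ (b * s) * ((a * d) * c)
exchange R = solve 5 (λ a s b c d → (a :* s) :* ((b :* c) :* d) := (b :* s) :* ((a :* d) :* c)) refl
  where
  open CommutativeRing R
  open import Algebra.Solver.Ring.NaturalCoefficients.Default commutativeSemiring using (solve; _:=_; _:*_)

module CharPoly {r ℓ} (R : CommutativeRing r ℓ) where
  open CommutativeRing R hiding (zero; rawRing; _+_)
  open CommutativeRing R using () renaming (_+_ to infixl 6 _⊞_)
  private
    raw = CommutativeRing.rawRing R
  open RingDefs raw using (O; _⊕_; δ; Symmetric; _*ᴾ_; _≈ᴾ_)
  open import Algebra.Properties.Ring ring using (-0#≈0#; -‿+-comm)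
  open Polynomial R using (polyRing)
  private
    module P = CommutativeRing polyRing
  open Determinant polyRing
  open Determinant R using () renaming (_≋_ to _≋ᴿ_)

  χ : ∀ {n} → Matrix Carrier n n → RingDefs.Poly raw
  χ = charPoly raw

  -- Restricting x I to a diagonal block gives x I again.
  δ-injective : ∀ {m n} (f : Fin m → Fin n) → Injective _≡_ _≡_ f → ∀ i j → δ (f i) (f j) ≡ δ i j
  δ-injective f f-inj i j with i ≟ j | f i ≟ f j
  ... | yes _   | yes _     = ≡.refl
  ... | no  _   | no  _     = ≡.refl
  ... | yes i≡j | no  fi≢fj = contradiction (≡.cong f i≡j) fi≢fj
  ... | no  i≢j | yes fi≡fj = contradiction (f-inj fi≡fj) i≢j

  δ-≢ : ∀ {n} {i j : Fin n} → i ≢ j → δ i j ≡ 0#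
  δ-≢ {i = i} {j} i≢j with i ≟ j
  ... | yes i≡j = contradiction i≡j i≢j
  ... | no  _   = ≡.refl

  pair : ∀ {a a′ d d′} → a ≡ a′ → d ≡ d′ → - a ∷ d ∷ [] ≡ - a′ ∷ d′ ∷ []
  pair ≡.refl ≡.refl = ≡.refl

  pair-cong : ∀ {a a′ b b′} → a ≈ a′ → b ≈ b′ → a ∷ b ∷ [] ≈ᴾ a′ ∷ b′ ∷ []
  pair-cong a≈a′ b≈b′ zero          = a≈a′
  pair-cong a≈a′ b≈b′ (suc zero)    = b≈b′
  pair-cong a≈a′ b≈b′ (suc (suc i)) = refl

  χ-cong : ∀ {n} {M N : Matrix Carrier n n} → M ≋ᴿ N → χ M ≈ᴾ χ N
  χ-cong {M = M} {N} M≋N = det-cong {M = charMatrix raw M} {charMatrix raw N} λ i j → pair-cong (-‿cong (M≋N i j)) refl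

  -- The matrices of the theorem and their factorisation.

  -- Covers both matrices of the theorem: `C` is `glued (B ᵀ) G′ G` by computation, as `B ᵀ ᵀ`
  -- reduces to `B`.
  glued : ∀ {p q} → Matrix Carrier p q → Matrix Carrier q q → Matrix Carrier p p →
          Matrix Carrier (p + (q + q)) (p + (q + q))
  glued B G G′ = (G′  ∣ B ∣ B)
               ⟋ (B ᵀ ∣ O ∣ G)
               ⟋ (B ᵀ ∣ G ∣ O)

  crossed : ∀ {n} → Matrix Carrier n n → Matrix Carrier (n + n) (n + n)
  crossed G = (O ∣ G) ⟋ (G ∣ O)

  negated : ∀ {n} → Matrix Carrier n n → Matrix Carrier n n
  negated G i j = - G i j

  -- The last block of size `q` goes to the left summand, in the order that `doubled` expects.
  indices : ∀ p q → Fin (p + (q + q)) ↔ (Fin q ⊎ (Fin p ⊎ Fin q))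
  indices p q = ⊎-comm (Fin p ⊎ Fin q) (Fin q) ↔-∘
                (↔-sym (⊎-assoc 0ℓ (Fin p) (Fin q) (Fin q)) ↔-∘ ((↔-id (Fin p) ⊎-↔ +↔⊎) ↔-∘ +↔⊎))

  module _ {p q} (B : Matrix Carrier p q) (G : Matrix Carrier q q) (G′ : Matrix Carrier p p) where
    private
      open Inverse (indices p q) using (to; from; strictlyInverseˡ)
      A = glued B G G′

      from-injective : Injective _≡_ _≡_ from
      from-injective {s} {t} eq =
        ≡.trans (≡.sym (strictlyInverseˡ s)) (≡.trans (≡.cong to eq) (strictlyInverseˡ t))

      distinct : ∀ s t → s ≢ t → δ (from s) (from t) ≡ 0#
      distinct s t s≢t = δ-≢ (s≢t ∘ from-injective)

    glued-blocks : ∀ s t → A (from s) (from t) ≡ Determinant.doubled R G′ B (B ᵀ) O G s t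
    glued-blocks (inj₁ i) (inj₁ j)
      rewrite splitAt-↑ʳ p (q + q) (q ↑ʳ i) | splitAt-↑ʳ q q i
            | splitAt-↑ʳ p (q + q) (q ↑ʳ j) | splitAt-↑ʳ q q j = ≡.refl
    glued-blocks (inj₁ i) (inj₂ (inj₁ j))
      rewrite splitAt-↑ʳ p (q + q) (q ↑ʳ i) | splitAt-↑ʳ q q i | splitAt-↑ˡ p j (q + q) = ≡.refl
    glued-blocks (inj₁ i) (inj₂ (inj₂ j))
      rewrite splitAt-↑ʳ p (q + q) (q ↑ʳ i) | splitAt-↑ʳ q q i
            | splitAt-↑ʳ p (q + q) (j ↑ˡ q) | splitAt-↑ˡ q j q = ≡.refl
    glued-blocks (inj₂ (inj₁ i)) (inj₁ j)
      rewrite splitAt-↑ˡ p i (q + q) | splitAt-↑ʳ p (q + q) (q ↑ʳ j) | splitAt-↑ʳ q q j = ≡.refl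
    glued-blocks (inj₂ (inj₁ i)) (inj₂ (inj₁ j))
      rewrite splitAt-↑ˡ p i (q + q) | splitAt-↑ˡ p j (q + q) = ≡.refl
    glued-blocks (inj₂ (inj₁ i)) (inj₂ (inj₂ j))
      rewrite splitAt-↑ˡ p i (q + q) | splitAt-↑ʳ p (q + q) (j ↑ˡ q) | splitAt-↑ˡ q j q = ≡.refl
    glued-blocks (inj₂ (inj₂ i)) (inj₁ j)
      rewrite splitAt-↑ʳ p (q + q) (i ↑ˡ q) | splitAt-↑ˡ q i q
            | splitAt-↑ʳ p (q + q) (q ↑ʳ j) | splitAt-↑ʳ q q j = ≡.refl
    glued-blocks (inj₂ (inj₂ i)) (inj₂ (inj₁ j))
      rewrite splitAt-↑ʳ p (q + q) (i ↑ˡ q) | splitAt-↑ˡ q i q | splitAt-↑ˡ p j (q + q) = ≡.refl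
    glued-blocks (inj₂ (inj₂ i)) (inj₂ (inj₂ j))
      rewrite splitAt-↑ʳ p (q + q) (i ↑ˡ q) | splitAt-↑ˡ q i q
            | splitAt-↑ʳ p (q + q) (j ↑ˡ q) | splitAt-↑ˡ q j q = ≡.refl

    charMatrix-glued : ∀ s t → charMatrix raw A (from s) (from t) ≡
      doubled (charMatrix raw G′) (λ i j → - B i j ∷ 0# ∷ []) (λ i j → - B j i ∷ 0# ∷ [])
              (λ i j → - 0# ∷ δ i j ∷ []) (λ i j → - G i j ∷ 0# ∷ []) s t
    charMatrix-glued s@(inj₁ i)        t@(inj₁ j)        = pair (glued-blocks s t)
      (δ-injective (from ∘ inj₁) (inj₁-injective ∘ from-injective) i j)
    charMatrix-glued s@(inj₁ i)        t@(inj₂ (inj₁ j)) = pair (glued-blocks s t) (distinct s t λ ())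
    charMatrix-glued s@(inj₁ i)        t@(inj₂ (inj₂ j)) = pair (glued-blocks s t) (distinct s t λ ())
    charMatrix-glued s@(inj₂ (inj₁ i)) t@(inj₁ j)        = pair (glued-blocks s t) (distinct s t λ ())
    charMatrix-glued s@(inj₂ (inj₁ i)) t@(inj₂ (inj₁ j)) = pair (glued-blocks s t)
      (δ-injective (from ∘ inj₂ ∘ inj₁) (inj₁-injective ∘ inj₂-injective ∘ from-injective) i j)
    charMatrix-glued s@(inj₂ (inj₁ i)) t@(inj₂ (inj₂ j)) = pair (glued-blocks s t) (distinct s t λ ())
    charMatrix-glued s@(inj₂ (inj₂ i)) t@(inj₁ j)        = pair (glued-blocks s t) (distinct s t λ ())
    charMatrix-glued s@(inj₂ (inj₂ i)) t@(inj₂ (inj₁ j)) = pair (glued-blocks s t) (distinct s t λ ())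
    charMatrix-glued s@(inj₂ (inj₂ i)) t@(inj₂ (inj₂ j)) = pair (glued-blocks s t)
      (δ-injective (from ∘ inj₂ ∘ inj₂) (inj₂-injective ∘ inj₂-injective ∘ from-injective) i j)

    -- x I - M for M with rows (G′ 2B), (Bᵀ G).
    quotientMatrix : Fin p ⊎ Fin q → Fin p ⊎ Fin q → RingDefs.Poly raw
    quotientMatrix = block (charMatrix raw G′) (λ i j → - (B i j ⊞ B i j) ∷ 0# ∷ [])
                           (λ i j → - B j i ∷ 0# ∷ []) (charMatrix raw G)

    χ-glued : χ A ≈ᴾ χ (negated G) *ᴾ detOn +↔⊎ quotientMatrix
    χ-glued = begin
      det (charMatrix raw A)
        ≈⟨ detOn-from (indices p q) (charMatrix raw A) ⟨
      detOn (indices p q) (λ s t → charMatrix raw A (from s) (from t))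
        ≈⟨ detOn-cong (indices p q) {λ s t → charMatrix raw A (from s) (from t)} {doubled X Y Z T W}
             (λ s t → P.reflexive (charMatrix-glued s t)) ⟩
      detOn (indices p q) (doubled X Y Z T W)
        ≈⟨ detOn-doubled (indices p q) (↔-id (Fin q)) +↔⊎ {X} {Y} {Z} {T} {W} ⟩
      det T-W *ᴾ detOn +↔⊎ (block X Y+Y Z T+W)
        -- Here T is x I and W is -G, so T - W = x I + G belongs to -G and T + W = x I - G belongs
        -- to G.
        ≈⟨ P.*-cong {det T-W} {χ (negated G)} {detOn +↔⊎ (block X Y+Y Z T+W)} {detOn +↔⊎ quotientMatrix}
             (det-cong {M = T-W} {charMatrix raw (negated G)} λ i j →
               pair-cong (trans (+-congʳ -0#≈0#) (+-identityˡ _)) (trans (+-congˡ -0#≈0#) (+-identityʳ _)))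
             (detOn-cong (+↔⊎ {p} {q}) {block X Y+Y Z T+W} {quotientMatrix} quotient-entry) ⟩
      χ (negated G) *ᴾ detOn +↔⊎ quotientMatrix ∎
      where
      open import Relation.Binary.Reasoning.Setoid P.setoid
      open RingDefs (RingDefs.polyRawRing raw) using (det)
      X = charMatrix raw G′
      Y Y+Y : Matrix (RingDefs.Poly raw) p q
      Z : Matrix (RingDefs.Poly raw) q p
      T W T+W T-W : Matrix (RingDefs.Poly raw) q q
      Y i j = - B i j ∷ 0# ∷ []
      Z i j = - B j i ∷ 0# ∷ []
      T i j = - 0# ∷ δ i j ∷ []
      W i j = - G i j ∷ 0# ∷ []
      Y+Y i j = Y i j P.+ Y i j
      T+W i j = T i j P.+ W i j
      T-W i j = T i j P.- W i j

      quotient-entry : ∀ i j → block X Y+Y Z T+W i j ≈ᴾ quotientMatrix i j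
      quotient-entry (inj₁ i) (inj₁ j) = P.refl {X i j}
      quotient-entry (inj₁ i) (inj₂ j) = pair-cong (-‿+-comm _ _) (+-identityˡ 0#)
      quotient-entry (inj₂ i) (inj₁ j) = P.refl {Z i j}
      quotient-entry (inj₂ i) (inj₂ j) = pair-cong (trans (+-congʳ -0#≈0#) (+-identityˡ _)) (+-identityʳ _)

  δ-sym : ∀ {n} (i j : Fin n) → δ i j ≡ δ j i
  δ-sym i j with i ≟ j | j ≟ i
  ... | yes _   | yes _   = ≡.refl
  ... | no  _   | no  _   = ≡.refl
  ... | yes i≡j | no  j≢i = contradiction (≡.sym i≡j) j≢i
  ... | no  i≢j | yes j≡i = contradiction (≡.sym j≡i) i≢j

  charMatrix-symmetric : ∀ {n} {M : Matrix Carrier n n} → Symmetric M →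
                         ∀ i j → charMatrix raw M i j ≈ᴾ charMatrix raw M j i
  charMatrix-symmetric M-sym i j = pair-cong (-‿cong (M-sym i j)) (reflexive (δ-sym i j))

  quotientMatrix-flip : ∀ {p q} (B : Matrix Carrier p q) (G : Matrix Carrier q q) (G′ : Matrix Carrier p p) →
                        Symmetric G → Symmetric G′ →
                        detOn +↔⊎ (quotientMatrix B G G′) ≈ᴾ detOn +↔⊎ (quotientMatrix (B ᵀ) G′ G)
  quotientMatrix-flip {p} {q} B G G′ G-sym G′-sym = P.trans
    {detOn +↔⊎ (quotientMatrix B G G′)} {detOn +↔⊎ flipped} {detOn +↔⊎ (quotientMatrix (B ᵀ) G′ G)}
    (detOn-block-flip (+↔⊎ {p} {q}) (+↔⊎ {q} {p}) {charMatrix raw G′} {λ i j → - (B i j ⊞ B i j) ∷ 0# ∷ []}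
      {λ i j → - B j i ∷ 0# ∷ []} {charMatrix raw G})
    (detOn-cong (+↔⊎ {q} {p}) {flipped} {quotientMatrix (B ᵀ) G′ G} entry)
    where
    flipped : Fin q ⊎ Fin p → Fin q ⊎ Fin p → RingDefs.Poly raw
    flipped = block (λ i j → charMatrix raw G j i) (λ i j → - (B j i ⊞ B j i) ∷ 0# ∷ [])
                    (λ i j → - B i j ∷ 0# ∷ []) (λ i j → charMatrix raw G′ j i)

    entry : ∀ i j → flipped i j ≈ᴾ quotientMatrix (B ᵀ) G′ G i j
    entry (inj₁ i) (inj₁ j) = charMatrix-symmetric G-sym j i
    entry (inj₁ i) (inj₂ j) = P.refl {flipped (inj₁ i) (inj₂ j)}
    entry (inj₂ i) (inj₁ j) = P.refl {flipped (inj₂ i) (inj₁ j)}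
    entry (inj₂ i) (inj₂ j) = charMatrix-symmetric G′-sym j i

  χ-crossed : ∀ {n} (G : Matrix Carrier n n) → χ (crossed G) ≈ᴾ χ (negated G) *ᴾ χ G
  -- For `p = 0` the index `i` is enumerated as `inj₂ i`, so the remaining factor is χ(G) by
  -- computation.
  χ-crossed G = χ-glued {0} (λ ()) G (λ ())

  χ-⊕ : ∀ {m n} (M : Matrix Carrier m m) (N : Matrix Carrier n n) → χ (M ⊕ N) ≈ᴾ χ M *ᴾ χ N
  χ-⊕ {m} {n} M N = begin
    det E
      -- The entries of this block are lists of two zeros, equal to the zero polynomial `[]` only up
      -- to `_≈ᴾ_`.
      ≈⟨ det-block m E (λ i j → P.trans {E (i ↑ˡ n) (m ↑ʳ j)} {(- 0#) ∷ 0# ∷ []} {[]}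
           (P.reflexive (pair (⊕₁₂ i j) (δ-≢ (↑ˡ≢↑ʳ i j))))
           λ { zero → -0#≈0# ; (suc zero) → refl ; (suc (suc k)) → refl }) ⟩
    det E₁₁ *ᴾ det E₂₂
      ≈⟨ P.*-cong {det E₁₁} {χ M} {det E₂₂} {χ N}
           (det-cong {M = E₁₁} {charMatrix raw M} λ i j →
             P.reflexive (pair (⊕₁₁ i j) (δ-injective (_↑ˡ n) (↑ˡ-injective n _ _) i j)))
           (det-cong {M = E₂₂} {charMatrix raw N} λ i j →
             P.reflexive (pair (⊕₂₂ i j) (δ-injective (m ↑ʳ_) (↑ʳ-injective m _ _) i j))) ⟩
    χ M *ᴾ χ N ∎
    where
    open import Relation.Binary.Reasoning.Setoid P.setoid
    open RingDefs (RingDefs.polyRawRing raw) using (det)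

    E   = charMatrix raw (M ⊕ N)
    E₁₁ : Matrix (RingDefs.Poly raw) m m
    E₂₂ : Matrix (RingDefs.Poly raw) n n
    E₁₁ i j = E (i ↑ˡ n) (j ↑ˡ n)
    E₂₂ i j = E (m ↑ʳ i) (m ↑ʳ j)

    ⊕₁₁ : ∀ i j → (M ⊕ N) (i ↑ˡ n) (j ↑ˡ n) ≡ M i j
    ⊕₁₁ i j rewrite splitAt-↑ˡ m i n | splitAt-↑ˡ m j n = ≡.refl

    ⊕₁₂ : ∀ i j → (M ⊕ N) (i ↑ˡ n) (m ↑ʳ j) ≡ 0#
    ⊕₁₂ i j rewrite splitAt-↑ˡ m i n | splitAt-↑ʳ m n j = ≡.refl

    ⊕₂₂ : ∀ i j → (M ⊕ N) (m ↑ʳ i) (m ↑ʳ j) ≡ N i j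
    ⊕₂₂ i j rewrite splitAt-↑ʳ m n i | splitAt-↑ʳ m n j = ≡.refl

    ↑ˡ≢↑ʳ : ∀ (i : Fin m) (j : Fin n) → i ↑ˡ n ≢ m ↑ʳ j
    ↑ˡ≢↑ʳ i j eq with () ← ≡.trans (≡.sym (splitAt-↑ˡ m i n)) (≡.trans (≡.cong (splitAt m) eq) (splitAt-↑ʳ m n j))

  χ-glued-⊕ : ∀ {p q} (B : Matrix Carrier p q) (G : Matrix Carrier q q) (G′ : Matrix Carrier p p) →
              χ (glued B G G′ ⊕ crossed G′ ⊕ G) ≈ᴾ
              (χ (negated G) *ᴾ detOn +↔⊎ (quotientMatrix B G G′)) *ᴾ ((χ (negated G′) *ᴾ χ G′) *ᴾ χ G)
  χ-glued-⊕ B G G′ = begin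
    χ (glued B G G′ ⊕ crossed G′ ⊕ G)
      ≈⟨ χ-⊕ (glued B G G′) (crossed G′ ⊕ G) ⟩
    χ (glued B G G′) *ᴾ χ (crossed G′ ⊕ G)
      ≈⟨ P.*-cong {χ (glued B G G′)} {v} {χ (crossed G′ ⊕ G)} {χ (crossed G′) *ᴾ χ G} (χ-glued B G G′) (χ-⊕ (crossed G′) G) ⟩
    v *ᴾ (χ (crossed G′) *ᴾ χ G)
      ≈⟨ P.*-congˡ {v} {χ (crossed G′) *ᴾ χ G} {w *ᴾ χ G} (P.*-congʳ {χ G} {χ (crossed G′)} {w} (χ-crossed G′)) ⟩
    v *ᴾ (w *ᴾ χ G) ∎
    where
    open import Relation.Binary.Reasoning.Setoid P.setoid
    v = χ (negated G) *ᴾ detOn +↔⊎ (quotientMatrix B G G′)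
    w = χ (negated G′) *ᴾ χ G′

  χ-glued-⊕-swap : ∀ {p q} (B : Matrix Carrier p q) (G : Matrix Carrier q q) (G′ : Matrix Carrier p p) →
                   Symmetric G → Symmetric G′ →
                   χ (glued B G G′ ⊕ crossed G′ ⊕ G) ≈ᴾ χ (glued (B ᵀ) G′ G ⊕ crossed G ⊕ G′)
  χ-glued-⊕-swap B G G′ G-sym G′-sym = begin
    χ (glued B G G′ ⊕ crossed G′ ⊕ G)
      ≈⟨ χ-glued-⊕ B G G′ ⟩
    (χ (negated G) *ᴾ s) *ᴾ ((χ (negated G′) *ᴾ χ G′) *ᴾ χ G)
      ≈⟨ P.*-congʳ {(χ (negated G′) *ᴾ χ G′) *ᴾ χ G} {χ (negated G) *ᴾ s} {χ (negated G) *ᴾ s′}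
           (P.*-congˡ {χ (negated G)} {s} {s′} (quotientMatrix-flip B G G′ G-sym G′-sym)) ⟩
    (χ (negated G) *ᴾ s′) *ᴾ ((χ (negated G′) *ᴾ χ G′) *ᴾ χ G)
      ≈⟨ exchange polyRing (χ (negated G)) s′ (χ (negated G′)) (χ G′) (χ G) ⟩
    (χ (negated G′) *ᴾ s′) *ᴾ ((χ (negated G) *ᴾ χ G) *ᴾ χ G′)
      ≈⟨ χ-glued-⊕ (B ᵀ) G′ G ⟨
    χ (glued (B ᵀ) G′ G ⊕ crossed G ⊕ G′) ∎
    where
    open import Relation.Binary.Reasoning.Setoid P.setoid
    s  = detOn +↔⊎ (quotientMatrix B G G′)
    s′ = detOn +↔⊎ (quotientMatrix (B ᵀ) G′ G)

-- Compatibility of block constructions with a change of ring.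

module BlockMap {a b ℓ} {A : Set a} (R : CommutativeRing b ℓ) (ι : A → CommutativeRing.Carrier R) where
  open Determinant R using (_≋_)

  map-∣ : ∀ {m k l} {M : Matrix A m k} {N : Matrix A m l} {M′ N′} →
          mapᴹ ι M ≋ M′ → mapᴹ ι N ≋ N′ → mapᴹ ι (M ∣ N) ≋ (M′ ∣ N′)
  map-∣ {k = k} M≋M′ N≋N′ i j with splitAt k j
  ... | inj₁ j′ = M≋M′ i j′
  ... | inj₂ j′ = N≋N′ i j′

  map-⟋ : ∀ {k l n} {M : Matrix A k n} {N : Matrix A l n} {M′ N′} →
          mapᴹ ι M ≋ M′ → mapᴹ ι N ≋ N′ → mapᴹ ι (M ⟋ N) ≋ (M′ ⟋ N′)
  map-⟋ {k = k} M≋M′ N≋N′ i j with splitAt k i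
  ... | inj₁ i′ = M≋M′ i′ j
  ... | inj₂ i′ = N≋N′ i′ j

-- `Cospectral` maps the assembled matrices. Their entries come from `B`, `G` and `G′` apart from
-- zero blocks, so `ι-0#` identifies the images with matrices assembled over `L`, where the
-- factorisation is then applied directly.
module BaseChange {a b ℓ₁ ℓ₂} (K : CommutativeRing a ℓ₁) (L : CommutativeRing b ℓ₂)
  (ι : CommutativeRing.Carrier K → CommutativeRing.Carrier L)
  (ι-0# : CommutativeRing._≈_ L (ι (CommutativeRing.0# K)) (CommutativeRing.0# L)) where
  open CommutativeRing K using (Carrier)
  open CommutativeRing L using (refl)
  open Determinant L using (_≋_)
  open BlockMap L ι
  private
    module K = RingDefs (CommutativeRing.rawRing K)
    module L = RingDefs (CommutativeRing.rawRing L)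
    module CK = CharPoly K
    module CL = CharPoly L

  map-id : ∀ {m n} (M : Matrix Carrier m n) → mapᴹ ι M ≋ mapᴹ ι M
  map-id M i j = refl

  map-O : ∀ {m n} → mapᴹ ι (K.O {m} {n}) ≋ L.O
  map-O i j = ι-0#

  map-⊕ : ∀ {m n} {M : Matrix Carrier m m} {N : Matrix Carrier n n} {M′ N′} →
          mapᴹ ι M ≋ M′ → mapᴹ ι N ≋ N′ → mapᴹ ι (M K.⊕ N) ≋ (M′ L.⊕ N′)
  map-⊕ M≋M′ N≋N′ = map-⟋ (map-∣ M≋M′ map-O) (map-∣ map-O N≋N′)

  map-crossed : ∀ {n} (G : Matrix Carrier n n) → mapᴹ ι (CK.crossed G) ≋ CL.crossed (mapᴹ ι G)
  map-crossed G = map-⟋ (map-∣ map-O (map-id G)) (map-∣ (map-id G) map-O)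

  map-glued : ∀ {p q} (B : Matrix Carrier p q) (G : Matrix Carrier q q) (G′ : Matrix Carrier p p) →
              mapᴹ ι (CK.glued B G G′) ≋ CL.glued (mapᴹ ι B) (mapᴹ ι G) (mapᴹ ι G′)
  map-glued B G G′ =
    map-⟋ (map-∣ (map-id G′) (map-∣ (map-id B) (map-id B)))
    (map-⟋ (map-∣ (map-id (B ᵀ)) (map-∣ map-O (map-id G)))
           (map-∣ (map-id (B ᵀ)) (map-∣ (map-id G) map-O)))

  map-glued-⊕ : ∀ {p q} (B : Matrix Carrier p q) (G : Matrix Carrier q q) (G′ : Matrix Carrier p p) →
                mapᴹ ι (CK.glued B G G′ K.⊕ CK.crossed G′ K.⊕ G) ≋
                (CL.glued (mapᴹ ι B) (mapᴹ ι G) (mapᴹ ι G′) L.⊕ CL.crossed (mapᴹ ι G′) L.⊕ mapᴹ ι G)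
  map-glued-⊕ B G G′ = map-⊕ (map-glued B G G′) (map-⊕ (map-crossed G′) (map-id G))

-- From characteristic polynomials to multiplicities.

fieldRing : ∀ {c ℓ₁ ℓ₂} → HeytingField c ℓ₁ ℓ₂ → CommutativeRing c ℓ₁
fieldRing K = HeytingCommutativeRing.commutativeRing (HeytingField.heytingCommutativeRing K)

rootMultiplicity-resp : ∀ {c ℓ₁ ℓ₂} (L : HeytingField c ℓ₁ ℓ₂) →
  let open RingDefs (rawRing L) using (_≈ᴾ_)
      open FieldDefs L using (IsRootOfMultiplicity)
  in
  ∀ f g μ k → f ≈ᴾ g → IsRootOfMultiplicity f μ k → IsRootOfMultiplicity g μ k
rootMultiplicity-resp L f g μ k f≈g (h , f≈ , h≉0) = h , (λ i → trans (sym (f≈g i)) (f≈ i)) , h≉0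
  where open HeytingField L using (trans; sym)

theorem3p8 : ∀ {c ℓ₁ ℓ₂} (K : HeytingField c ℓ₁ ℓ₂) →
    let open HeytingField K using (Carrier)
        open RingDefs (rawRing K)
    in
    ∀ (p q : ℕ)
    (B : Matrix Carrier p q) (G : Matrix Carrier q q) (G′ : Matrix Carrier p p) →
    Symmetric G → Symmetric G′ →
    let A : Matrix Carrier (p + (q + q)) (p + (q + q))
        A = (G′  ∣ B ∣ B)
          ⟋ (B ᵀ ∣ O ∣ G)
          ⟋ (B ᵀ ∣ G ∣ O)
        C : Matrix Carrier (q + (p + p)) (q + (p + p))
        C = (G ∣ B ᵀ ∣ B ᵀ)
          ⟋ (B ∣ O   ∣ G′)
          ⟋ (B ∣ G′  ∣ O)
    in
    Cospectral K
      (A ⊕ ((O ∣ G′) ⟋ (G′ ∣ O)) ⊕ G)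
      (C ⊕ ((O ∣ G) ⟋ (G ∣ O)) ⊕ G′)
theorem3p8 K p q B G G′ G-sym G′-sym L ι ι-hom μ k =
  mk⇔ (rootMultiplicity-resp L χᴬ χᶜ μ k χᴬ≈χᶜ) (rootMultiplicity-resp L χᶜ χᴬ μ k λ i → sym (χᴬ≈χᶜ i))
  where
  open RingMorphisms (rawRing K) (rawRing L) using (module IsRingHomomorphism)
  open IsRingHomomorphism ι-hom using (⟦⟧-cong; 0#-homo)
  open HeytingField L using (sym; trans)
  open BaseChange (fieldRing K) (fieldRing L) ι 0#-homo using (map-glued-⊕)
  open RingDefs (rawRing K) using (_⊕_)
  open RingDefs (rawRing L) using (Poly; _≈ᴾ_)
  module CK = CharPoly (fieldRing K)
  module CL = CharPoly (fieldRing L)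

  χᴬ χᶜ : Poly
  χᴬ = CL.χ (mapᴹ ι (CK.glued B G G′ ⊕ CK.crossed G′ ⊕ G))
  χᶜ = CL.χ (mapᴹ ι (CK.glued (B ᵀ) G′ G ⊕ CK.crossed G ⊕ G′))

  χᴬ≈χᶜ : χᴬ ≈ᴾ χᶜ
  χᴬ≈χᶜ i = trans (CL.χ-cong (map-glued-⊕ B G G′) i)
    (trans (CL.χ-glued-⊕-swap (mapᴹ ι B) (mapᴹ ι G) (mapᴹ ι G′)
             (λ i j → ⟦⟧-cong (G-sym i j)) (λ i j → ⟦⟧-cong (G′-sym i j)) i)
           (sym (CL.χ-cong (map-glued-⊕ (B ᵀ) G′ G) i)))
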